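{- Let $\Lambda=\langle a_1\rangle\perp\cdots\perp\langle a_n\rangle=\mathcal{O}_Ds_1\perp\cdots\perp\mathcal{O}_Ds_n$ be a skew-hermitian lattice with $\nu(a_1)\le\cdots\le\nu(a_n)$, and assume $\mu(\Lambda)>\nu(4)$ and $N(a_2),\dots,N(a_n)\in N(a_1)k^{*2}$. Let $(s;\sigma)\in\mathcal{B}(\Lambda)$, i.e. $s=(1-r)s_m-s_0$ with $s_0=\lambda_{m+1}s_{m+1}+\cdots+\lambda_ns_n$ ($\lambda_l\in\mathcal{O}_D$), $\sigma=a_m(1-\bar r)$ and $|1-\bar r|\ge|2|$. If for some $t\in\{1,\dots,n-m\}$ we have $|\lambda_{m+t}|\ge|\lambda_{m+t+l}|$ for all $l\in\{1,\dots,n-m-t\}$, then there exists a lattice $\Lambda'=\langle b_1\rangle\perp\cdots\perp\langle b_{t+1}\rangle\subseteq\Lambda$ such that: (1) $(s;\sigma)\in\mathcal{U}^+_k(\Lambda')$; (2) $\mu(\Lambda')\ge\mu(\Lambda)$; (3) $N(b_i)\in N(a_1)k^{*2}$ for all $i=1,\dots,t+1$.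
   Context: $k$ is a dyadic local field of characteristic $0$ (finite extension of $\mathbb{Q}_2$), $\nu_k$ its normalized valuation, $|\cdot|_k$ its absolute value. $D$ is the quaternion division algebra over $k$ with canonical involution $q\mapsto\bar q$ and reduced norm $N$; $|q|:=|N(q)|_k$, $\nu(q):=\nu_k(N(q))$; $\mathcal{O}_D=\{q:|q|\le1\}$. A skew-hermitian space is a free $D$-module $V$ of finite rank with nondegenerate $h:V\times V\to D$, $D$-linear in the first variable, $h(x,y)=-\overline{h(y,x)}$. For pure quaternions $a_i$, $\langle a_1\rangle\perp\cdots\perp\langle a_n\rangle=\mathcal{O}_Ds_1\perp\cdots\perp\mathcal{O}_Ds_n$ means an orthogonal sum with $h(s_i,s_i)=a_i$; for such a lattice with $\nu(a_1)\le\cdots\le\nu(a_n)$, $\mu(\Lambda)=\min_i(\nu(a_{i+1})-\nu(a_i))$. For $s\in V$, $\sigma\in D^*$ with $\sigma-\bar\sigma=h(s,s)$, the simple rotation is $(s;\sigma)(x)=x-h(x,s)\sigma^{ -1}s$; it is an isometry. $\mathcal{U}^+_k(\Lambda)$ is the group of isometries of $h$ with $\phi(\Lambda)=\Lambda$. $\mathcal{B}(\Lambda)$ is the set of simple rotations $(s;\sigma)\in\mathcal{U}^+_k(\Lambda)$ for which there exist $m\in\{1,\dots,n\}$, $r\in\mathcal{O}_D$ with $|1-r|\ge|2|$ and $\lambda_{m+1},\dots,\lambda_n\in\mathcal{O}_D$ with $s=(1-r)s_m-\sum_{l>m}\lambda_ls_l$ and $\sigma=a_m(1-\bar r)$. 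-}

module Defs where

open import Level using (Level; _⊔_) renaming (suc to lsuc)
open import Algebra.Bundles using (CommutativeRing; Ring; RawRing)
open import Algebra.Structures using (IsRing)
open import Algebra.Module.Bundles using (LeftModule)
open import Algebra.Solver.Ring.AlmostCommutativeRing using (fromCommutativeRing; _-Raw-AlmostCommutative⟶_)
import Algebra.Definitions.RawMonoid
import Algebra.Properties.AbelianGroup
import Algebra.Properties.CommutativeSemigroup
import Algebra.Properties.Ring
import Algebra.Properties.Semiring.Mult
import Algebra.Solver.Ring
open import Data.Bool.Base using (if_then_else_)
open import Data.Fin.Base using (Fin; zero; suc; inject₁)
import Data.Fin.Base as Fin
import Data.Fin.Properties as Finₚ
open import Data.Integer.Base using (ℤ; 0ℤ; 1ℤ)
import Data.Integer.Base as ℤ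
open import Data.List.Base using (List)
open import Data.List.Relation.Unary.All using (All)
open import Data.List.Relation.Unary.Any using (Any)
open import Data.Maybe.Base using (Maybe; just; nothing)
open import Data.Nat.Base using (ℕ; zero; suc)
import Data.Nat.Base as ℕ
import Data.Nat.Properties as ℕₚ
open import Data.Product.Base using (∃; _×_; _,_; proj₁)
open import Data.Vec.Functional using (foldr)
open import Relation.Binary.Construct.Add.Supremum.NonStrict ℤ._≤_ public using (_≤⁺_)
open import Relation.Binary.Construct.Add.Supremum.Strict ℤ._<_ public using (_<⁺_)
open import Relation.Binary.PropositionalEquality.Core using (_≡_; cong)
open import Relation.Binary.Structures using (IsEquivalence)
open import Relation.Nullary.Construct.Add.Supremum using (_⁺; ⊤⁺; [_])
open import Relation.Nullary.Decidable.Core using (does; yes; no)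
open import Relation.Nullary.Negation.Core using (¬_)

------------------------------------------------------------------------
-- Values of valuations: ℤ ∪ {∞}, with ∞ = ⊤⁺ the value of 0

ℤ∞ : Set
ℤ∞ = ℤ ⁺

infixl 6 _+∞_ _-∞_
infixl 7 _⊓∞_

_+∞_ : ℤ∞ → ℤ∞ → ℤ∞
[ x ] +∞ [ y ] = [ x ℤ.+ y ]
[ _ ] +∞ ⊤⁺    = ⊤⁺
⊤⁺    +∞ _     = ⊤⁺

-- Only ever applied to values of nonzero elements; the result when the
-- subtrahend is ∞ is irrelevant.
_-∞_ : ℤ∞ → ℤ∞ → ℤ∞
[ x ] -∞ [ y ] = [ x ℤ.- y ]
[ _ ] -∞ ⊤⁺    = ⊤⁺
⊤⁺    -∞ _     = ⊤⁺

_⊓∞_ : ℤ∞ → ℤ∞ → ℤ∞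
[ x ] ⊓∞ [ y ] = [ x ℤ.⊓ y ]
[ x ] ⊓∞ ⊤⁺    = [ x ]
⊤⁺    ⊓∞ y     = y

------------------------------------------------------------------------
-- Dyadic local fields of characteristic 0: fields of characteristic 0,
-- complete for a normalized discrete valuation with finite residue
-- field of characteristic 2.

record DyadicLocalField c ℓ : Set (lsuc (c ⊔ ℓ)) where
  field
    commutativeRing : CommutativeRing c ℓ

  open CommutativeRing commutativeRing public
  open Algebra.Definitions.RawMonoid +-rawMonoid public using () renaming (_×_ to _·_)

  field
    inverse          : ∀ x → x ≉ 0# → ∃ λ y → x * y ≈ 1#
    characteristic-0 : ∀ n → suc n · 1# ≉ 0#

    ν            : Carrier → ℤ∞
    ν-cong       : ∀ {x y} → x ≈ y → ν x ≡ ν y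
    ν-0          : ν 0# ≡ ⊤⁺
    ν-∞          : ∀ x → ν x ≡ ⊤⁺ → x ≈ 0#
    ν-*          : ∀ x y → ν (x * y) ≡ ν x +∞ ν y
    ν-+          : ∀ x y → ν x ⊓∞ ν y ≤⁺ ν (x + y)
    ν-normalized : ∃ λ π → ν π ≡ [ 1ℤ ]

  Cauchy : (ℕ → Carrier) → Set
  Cauchy x = ∀ (e : ℤ) → ∃ λ M → ∀ i j → M ℕ.≤ i → M ℕ.≤ j → [ e ] ≤⁺ ν (x i - x j)

  _⟶_ : (ℕ → Carrier) → Carrier → Set
  x ⟶ y = ∀ (e : ℤ) → ∃ λ M → ∀ i → M ℕ.≤ i → [ e ] ≤⁺ ν (x i - y)

  Integral : Carrier → Set
  Integral x = [ 0ℤ ] ≤⁺ ν x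

  field
    complete : ∀ x → Cauchy x → ∃ λ y → x ⟶ y

    -- a finite list of integers meeting every residue class
    residueField-finite : ∃ λ (xs : List Carrier) → All Integral xs ×
      (∀ x → Integral x → Any (λ y → [ 0ℤ ] <⁺ ν (x - y)) xs)
    residueField-char-2 : [ 0ℤ ] <⁺ ν (1# + 1#)

------------------------------------------------------------------------
-- The quaternion algebra (α, β / R): basis 1, i, j, k = ij with i² = α,
-- j² = β, ij = - ji

record Quaternion {c} (A : Set c) : Set c where
  constructor quat
  field
    re im-i im-j im-k : A

module QuaternionAlgebra {c ℓ} (R : CommutativeRing c ℓ)
                         (α β : CommutativeRing.Carrier R) where

  private
    module R = CommutativeRing R
  open R using () renaming
    (Carrier to K; _+_ to _+ᴷ_; _*_ to _*ᴷ_; -_ to -ᴷ_; _-_ to _-ᴷ_; _≈_ to _≈ᴷ_)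

  infix 4 _≈_

  record _≈_ (p q : Quaternion K) : Set ℓ where
    constructor eq
    private
      module p = Quaternion p
      module q = Quaternion q
    field
      re-≈ : p.re ≈ᴷ q.re
      i-≈  : p.im-i ≈ᴷ q.im-i
      j-≈  : p.im-j ≈ᴷ q.im-j
      k-≈  : p.im-k ≈ᴷ q.im-k

  infixl 6 _+_
  infixl 7 _*_
  infix 8 -_

  ι : K → Quaternion K
  ι x = quat x R.0# R.0# R.0#

  0# 1# : Quaternion K
  0# = ι R.0#
  1# = ι R.1#

  _+_ : Quaternion K → Quaternion K → Quaternion K
  quat a b c d + quat a′ b′ c′ d′ = quat (a +ᴷ a′) (b +ᴷ b′) (c +ᴷ c′) (d +ᴷ d′)

  -_ : Quaternion K → Quaternion K
  - quat a b c d = quat (-ᴷ a) (-ᴷ b) (-ᴷ c) (-ᴷ d)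

  _*_ : Quaternion K → Quaternion K → Quaternion K
  quat a b c d * quat a′ b′ c′ d′ = quat
    (a *ᴷ a′ +ᴷ α *ᴷ (b *ᴷ b′) +ᴷ β *ᴷ (c *ᴷ c′) -ᴷ α *ᴷ β *ᴷ (d *ᴷ d′))
    (a *ᴷ b′ +ᴷ b *ᴷ a′ -ᴷ β *ᴷ (c *ᴷ d′) +ᴷ β *ᴷ (d *ᴷ c′))
    (a *ᴷ c′ +ᴷ c *ᴷ a′ +ᴷ α *ᴷ (b *ᴷ d′) -ᴷ α *ᴷ (d *ᴷ b′))
    (a *ᴷ d′ +ᴷ d *ᴷ a′ +ᴷ b *ᴷ c′ -ᴷ c *ᴷ b′)

  conj : Quaternion K → Quaternion K
  conj (quat a b c d) = quat a (-ᴷ b) (-ᴷ c) (-ᴷ d)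

  -- The reduced norm: q * conj q = ι (N q).
  N : Quaternion K → K
  N (quat a b c d) =
    a *ᴷ a -ᴷ α *ᴷ (b *ᴷ b) -ᴷ β *ᴷ (c *ᴷ c) +ᴷ α *ᴷ β *ᴷ (d *ᴷ d)

  -- A solver for identities in R; a coefficient (m , n) stands for m - n.
  module Solver where
    open Algebra.Properties.Semiring.Mult R.semiring using (×-homo-+; ×1-homo-*) renaming (_×_ to _·_)
    open Algebra.Properties.AbelianGroup R.+-abelianGroup using (⁻¹-∙-comm; ⁻¹-involutive)
    open Algebra.Properties.CommutativeSemigroup R.+-commutativeSemigroup using (interchange)
    open Algebra.Properties.Ring R.ring using (-‿distribˡ-*; -‿distribʳ-*)
    open import Relation.Binary.Reasoning.Setoid R.setoid

    Coeff : RawRing _ _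
    Coeff = record
      { Carrier = ℕ × ℕ
      ; _≈_     = _≡_
      ; _+_     = λ { (a , b) (c , d) → a ℕ.+ c , b ℕ.+ d }
      ; _*_     = λ { (a , b) (c , d) → a ℕ.* c ℕ.+ b ℕ.* d , a ℕ.* d ℕ.+ b ℕ.* c }
      ; -_      = λ { (a , b) → b , a }
      ; 0#      = 0 , 0
      ; 1#      = 1 , 0
      }

    ⟦_⟧ᶜ : ℕ × ℕ → K
    ⟦ a , b ⟧ᶜ = a · R.1# -ᴷ b · R.1#

    private
      +-sub : ∀ A B C D → (A +ᴷ C) -ᴷ (B +ᴷ D) ≈ᴷ (A -ᴷ B) +ᴷ (C -ᴷ D)
      +-sub A B C D = R.trans (R.+-congˡ (R.sym (⁻¹-∙-comm B D))) (interchange A C (-ᴷ B) (-ᴷ D))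

      neg-sub : ∀ A B → B -ᴷ A ≈ᴷ -ᴷ (A -ᴷ B)
      neg-sub A B = begin
        B -ᴷ A             ≈⟨ R.+-comm B (-ᴷ A) ⟩
        -ᴷ A +ᴷ B          ≈⟨ R.+-congˡ (R.sym (⁻¹-involutive B)) ⟩
        -ᴷ A +ᴷ -ᴷ (-ᴷ B)  ≈⟨ ⁻¹-∙-comm A (-ᴷ B) ⟩
        -ᴷ (A -ᴷ B)        ∎

      *-subˡ : ∀ A C D → A *ᴷ (C -ᴷ D) ≈ᴷ A *ᴷ C -ᴷ A *ᴷ D
      *-subˡ A C D = R.trans (R.distribˡ A C (-ᴷ D)) (R.+-congˡ (R.sym (-‿distribʳ-* A D)))

      *-sub : ∀ A B C D →
        (A *ᴷ C +ᴷ B *ᴷ D) -ᴷ (A *ᴷ D +ᴷ B *ᴷ C) ≈ᴷ (A -ᴷ B) *ᴷ (C -ᴷ D)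
      *-sub A B C D = begin
        (A *ᴷ C +ᴷ B *ᴷ D) -ᴷ (A *ᴷ D +ᴷ B *ᴷ C)    ≈⟨ +-sub _ _ _ _ ⟩
        (A *ᴷ C -ᴷ A *ᴷ D) +ᴷ (B *ᴷ D -ᴷ B *ᴷ C)    ≈⟨ R.+-cong (R.sym (*-subˡ A C D)) (neg-sub (B *ᴷ C) (B *ᴷ D)) ⟩
        A *ᴷ (C -ᴷ D) +ᴷ -ᴷ (B *ᴷ C -ᴷ B *ᴷ D)      ≈⟨ R.+-congˡ (R.-‿cong (R.sym (*-subˡ B C D))) ⟩
        A *ᴷ (C -ᴷ D) +ᴷ -ᴷ (B *ᴷ (C -ᴷ D))         ≈⟨ R.+-congˡ (-‿distribˡ-* B (C -ᴷ D)) ⟩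
        A *ᴷ (C -ᴷ D) +ᴷ (-ᴷ B) *ᴷ (C -ᴷ D)         ≈⟨ R.sym (R.distribʳ (C -ᴷ D) A (-ᴷ B)) ⟩
        (A -ᴷ B) *ᴷ (C -ᴷ D)                        ∎

      sub-cancelʳ : ∀ A B C → A -ᴷ B ≈ᴷ (A +ᴷ C) -ᴷ (B +ᴷ C)
      sub-cancelʳ A B C = R.sym (R.trans (+-sub A B C C)
        (R.trans (R.+-congˡ (R.-‿inverseʳ C)) (R.+-identityʳ _)))

    morphism : Coeff -Raw-AlmostCommutative⟶ fromCommutativeRing R
    morphism = record
      { ⟦_⟧    = ⟦_⟧ᶜ
      ; +-homo = λ { (a , b) (c , d) → R.trans
          (R.+-cong (×-homo-+ R.1# a c) (R.-‿cong (×-homo-+ R.1# b d))) (+-sub _ _ _ _) }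
      ; *-homo = λ { (a , b) (c , d) → R.trans
          (R.+-cong
            (R.trans (×-homo-+ R.1# (a ℕ.* c) (b ℕ.* d)) (R.+-cong (×1-homo-* a c) (×1-homo-* b d)))
            (R.-‿cong (R.trans (×-homo-+ R.1# (a ℕ.* d) (b ℕ.* c)) (R.+-cong (×1-homo-* a d) (×1-homo-* b c)))))
          (*-sub _ _ _ _) }
      ; -‿homo = λ { (a , b) → neg-sub (a · R.1#) (b · R.1#) }
      ; 0-homo = R.-‿inverseʳ R.0#
      ; 1-homo = R.trans
          (R.+-cong (R.+-identityʳ R.1#) (R.trans (R.sym (R.+-identityˡ _)) (R.-‿inverseʳ R.0#)))
          (R.+-identityʳ R.1#)
      }

    _≟ᶜ_ : ∀ x y → Maybe (⟦ x ⟧ᶜ ≈ᴷ ⟦ y ⟧ᶜ)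
    (a , b) ≟ᶜ (c , d) with a ℕ.+ d ℕₚ.≟ c ℕ.+ b
    ... | no _  = nothing
    ... | yes p = just (begin
      ⟦ a , b ⟧ᶜ                              ≈⟨ sub-cancelʳ _ _ (d · R.1#) ⟩
      (a · R.1# +ᴷ d · R.1#) -ᴷ (b · R.1# +ᴷ d · R.1#)
        ≈⟨ R.+-cong (R.sym (×-homo-+ R.1# a d)) (R.-‿cong (R.+-comm _ _)) ⟩
      (a ℕ.+ d) · R.1# -ᴷ (d · R.1# +ᴷ b · R.1#)
        ≈⟨ R.+-congʳ (R.reflexive (cong (_· R.1#) p)) ⟩
      (c ℕ.+ b) · R.1# -ᴷ (d · R.1# +ᴷ b · R.1#)
        ≈⟨ R.+-congʳ (×-homo-+ R.1# c b) ⟩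
      (c · R.1# +ᴷ b · R.1#) -ᴷ (d · R.1# +ᴷ b · R.1#)  ≈⟨ R.sym (sub-cancelʳ _ _ (b · R.1#)) ⟩
      ⟦ c , d ⟧ᶜ                              ∎)

    open Algebra.Solver.Ring Coeff (fromCommutativeRing R) morphism _≟ᶜ_ public

    module _ {n} (α̂ β̂ : Polynomial n) where
      _⊛_ : Quaternion (Polynomial n) → Quaternion (Polynomial n) → Quaternion (Polynomial n)
      quat a b c d ⊛ quat a′ b′ c′ d′ = quat
        (a :* a′ :+ α̂ :* (b :* b′) :+ β̂ :* (c :* c′) :- α̂ :* β̂ :* (d :* d′))
        (a :* b′ :+ b :* a′ :- β̂ :* (c :* d′) :+ β̂ :* (d :* c′))
        (a :* c′ :+ c :* a′ :+ α̂ :* (b :* d′) :- α̂ :* (d :* b′))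
        (a :* d′ :+ d :* a′ :+ b :* c′ :- c :* b′)

    _⊕_ : ∀ {n} → Quaternion (Polynomial n) → Quaternion (Polynomial n) → Quaternion (Polynomial n)
    quat a b c d ⊕ quat a′ b′ c′ d′ = quat (a :+ a′) (b :+ b′) (c :+ c′) (d :+ d′)

    𝟙 : ∀ {n} → Quaternion (Polynomial n)
    𝟙 = quat (con (1 , 0)) (con (0 , 0)) (con (0 , 0)) (con (0 , 0))

  open Solver using (solve; _:=_; _⊛_; _⊕_; 𝟙; ⟦_⟧ᶜ; morphism)

  ≈-isEquivalence : IsEquivalence _≈_
  ≈-isEquivalence = record
    { refl  = eq R.refl R.refl R.refl R.refl
    ; sym   = λ { (eq p q r s) → eq (R.sym p) (R.sym q) (R.sym r) (R.sym s) }
    ; trans = λ { (eq p q r s) (eq p′ q′ r′ s′) →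
                  eq (R.trans p p′) (R.trans q q′) (R.trans r r′) (R.trans s s′) }
    }

  private
    open module E = IsEquivalence ≈-isEquivalence using ()

  *-cong : ∀ {p p′ q q′} → p ≈ p′ → q ≈ q′ → p * q ≈ p′ * q′
  *-cong (eq a b c d) (eq a′ b′ c′ d′) = eq
    (R.+-cong (R.+-cong (R.+-cong (R.*-cong a a′) (R.*-congˡ (R.*-cong b b′)))
      (R.*-congˡ (R.*-cong c c′))) (R.-‿cong (R.*-congˡ (R.*-cong d d′))))
    (R.+-cong (R.+-cong (R.+-cong (R.*-cong a b′) (R.*-cong b a′))
      (R.-‿cong (R.*-congˡ (R.*-cong c d′)))) (R.*-congˡ (R.*-cong d c′)))
    (R.+-cong (R.+-cong (R.+-cong (R.*-cong a c′) (R.*-cong c a′))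
      (R.*-congˡ (R.*-cong b d′))) (R.-‿cong (R.*-congˡ (R.*-cong d b′))))
    (R.+-cong (R.+-cong (R.+-cong (R.*-cong a d′) (R.*-cong d a′))
      (R.*-cong b c′)) (R.-‿cong (R.*-cong c b′)))

  *-assoc : ∀ p q r → (p * q) * r ≈ p * (q * r)
  *-assoc (quat a b c d) (quat a′ b′ c′ d′) (quat a″ b″ c″ d″) = eq
    (solve 14 (λ α̂ β̂ a b c d a′ b′ c′ d′ a″ b″ c″ d″ → Quaternion.re (_⊛_ α̂ β̂ (_⊛_ α̂ β̂ (quat a b c d) (quat a′ b′ c′ d′)) (quat a″ b″ c″ d″)) := Quaternion.re (_⊛_ α̂ β̂ (quat a b c d) (_⊛_ α̂ β̂ (quat a′ b′ c′ d′) (quat a″ b″ c″ d″)))) R.refl α β a b c d a′ b′ c′ d′ a″ b″ c″ d″)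
    (solve 14 (λ α̂ β̂ a b c d a′ b′ c′ d′ a″ b″ c″ d″ → Quaternion.im-i (_⊛_ α̂ β̂ (_⊛_ α̂ β̂ (quat a b c d) (quat a′ b′ c′ d′)) (quat a″ b″ c″ d″)) := Quaternion.im-i (_⊛_ α̂ β̂ (quat a b c d) (_⊛_ α̂ β̂ (quat a′ b′ c′ d′) (quat a″ b″ c″ d″)))) R.refl α β a b c d a′ b′ c′ d′ a″ b″ c″ d″)
    (solve 14 (λ α̂ β̂ a b c d a′ b′ c′ d′ a″ b″ c″ d″ → Quaternion.im-j (_⊛_ α̂ β̂ (_⊛_ α̂ β̂ (quat a b c d) (quat a′ b′ c′ d′)) (quat a″ b″ c″ d″)) := Quaternion.im-j (_⊛_ α̂ β̂ (quat a b c d) (_⊛_ α̂ β̂ (quat a′ b′ c′ d′) (quat a″ b″ c″ d″)))) R.refl α β a b c d a′ b′ c′ d′ a″ b″ c″ d″)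
    (solve 14 (λ α̂ β̂ a b c d a′ b′ c′ d′ a″ b″ c″ d″ → Quaternion.im-k (_⊛_ α̂ β̂ (_⊛_ α̂ β̂ (quat a b c d) (quat a′ b′ c′ d′)) (quat a″ b″ c″ d″)) := Quaternion.im-k (_⊛_ α̂ β̂ (quat a b c d) (_⊛_ α̂ β̂ (quat a′ b′ c′ d′) (quat a″ b″ c″ d″)))) R.refl α β a b c d a′ b′ c′ d′ a″ b″ c″ d″)

  *-distribˡ-+ : ∀ p q r → p * (q + r) ≈ p * q + p * r
  *-distribˡ-+ (quat a b c d) (quat a′ b′ c′ d′) (quat a″ b″ c″ d″) = eq
    (solve 14 (λ α̂ β̂ a b c d a′ b′ c′ d′ a″ b″ c″ d″ → Quaternion.re (_⊛_ α̂ β̂ (quat a b c d) ((quat a′ b′ c′ d′) ⊕ (quat a″ b″ c″ d″))) := Quaternion.re ((_⊛_ α̂ β̂ (quat a b c d) (quat a′ b′ c′ d′)) ⊕ (_⊛_ α̂ β̂ (quat a b c d) (quat a″ b″ c″ d″)))) R.refl α β a b c d a′ b′ c′ d′ a″ b″ c″ d″)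
    (solve 14 (λ α̂ β̂ a b c d a′ b′ c′ d′ a″ b″ c″ d″ → Quaternion.im-i (_⊛_ α̂ β̂ (quat a b c d) ((quat a′ b′ c′ d′) ⊕ (quat a″ b″ c″ d″))) := Quaternion.im-i ((_⊛_ α̂ β̂ (quat a b c d) (quat a′ b′ c′ d′)) ⊕ (_⊛_ α̂ β̂ (quat a b c d) (quat a″ b″ c″ d″)))) R.refl α β a b c d a′ b′ c′ d′ a″ b″ c″ d″)
    (solve 14 (λ α̂ β̂ a b c d a′ b′ c′ d′ a″ b″ c″ d″ → Quaternion.im-j (_⊛_ α̂ β̂ (quat a b c d) ((quat a′ b′ c′ d′) ⊕ (quat a″ b″ c″ d″))) := Quaternion.im-j ((_⊛_ α̂ β̂ (quat a b c d) (quat a′ b′ c′ d′)) ⊕ (_⊛_ α̂ β̂ (quat a b c d) (quat a″ b″ c″ d″)))) R.refl α β a b c d a′ b′ c′ d′ a″ b″ c″ d″)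
    (solve 14 (λ α̂ β̂ a b c d a′ b′ c′ d′ a″ b″ c″ d″ → Quaternion.im-k (_⊛_ α̂ β̂ (quat a b c d) ((quat a′ b′ c′ d′) ⊕ (quat a″ b″ c″ d″))) := Quaternion.im-k ((_⊛_ α̂ β̂ (quat a b c d) (quat a′ b′ c′ d′)) ⊕ (_⊛_ α̂ β̂ (quat a b c d) (quat a″ b″ c″ d″)))) R.refl α β a b c d a′ b′ c′ d′ a″ b″ c″ d″)

  *-distribʳ-+ : ∀ p q r → (q + r) * p ≈ q * p + r * p
  *-distribʳ-+ (quat a b c d) (quat a′ b′ c′ d′) (quat a″ b″ c″ d″) = eq
    (solve 14 (λ α̂ β̂ a b c d a′ b′ c′ d′ a″ b″ c″ d″ → Quaternion.re (_⊛_ α̂ β̂ ((quat a′ b′ c′ d′) ⊕ (quat a″ b″ c″ d″)) (quat a b c d)) := Quaternion.re ((_⊛_ α̂ β̂ (quat a′ b′ c′ d′) (quat a b c d)) ⊕ (_⊛_ α̂ β̂ (quat a″ b″ c″ d″) (quat a b c d)))) R.refl α β a b c d a′ b′ c′ d′ a″ b″ c″ d″)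
    (solve 14 (λ α̂ β̂ a b c d a′ b′ c′ d′ a″ b″ c″ d″ → Quaternion.im-i (_⊛_ α̂ β̂ ((quat a′ b′ c′ d′) ⊕ (quat a″ b″ c″ d″)) (quat a b c d)) := Quaternion.im-i ((_⊛_ α̂ β̂ (quat a′ b′ c′ d′) (quat a b c d)) ⊕ (_⊛_ α̂ β̂ (quat a″ b″ c″ d″) (quat a b c d)))) R.refl α β a b c d a′ b′ c′ d′ a″ b″ c″ d″)
    (solve 14 (λ α̂ β̂ a b c d a′ b′ c′ d′ a″ b″ c″ d″ → Quaternion.im-j (_⊛_ α̂ β̂ ((quat a′ b′ c′ d′) ⊕ (quat a″ b″ c″ d″)) (quat a b c d)) := Quaternion.im-j ((_⊛_ α̂ β̂ (quat a′ b′ c′ d′) (quat a b c d)) ⊕ (_⊛_ α̂ β̂ (quat a″ b″ c″ d″) (quat a b c d)))) R.refl α β a b c d a′ b′ c′ d′ a″ b″ c″ d″)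
    (solve 14 (λ α̂ β̂ a b c d a′ b′ c′ d′ a″ b″ c″ d″ → Quaternion.im-k (_⊛_ α̂ β̂ ((quat a′ b′ c′ d′) ⊕ (quat a″ b″ c″ d″)) (quat a b c d)) := Quaternion.im-k ((_⊛_ α̂ β̂ (quat a′ b′ c′ d′) (quat a b c d)) ⊕ (_⊛_ α̂ β̂ (quat a″ b″ c″ d″) (quat a b c d)))) R.refl α β a b c d a′ b′ c′ d′ a″ b″ c″ d″)

  private
    1ᶜ : Quaternion K
    1ᶜ = quat ⟦ 1 , 0 ⟧ᶜ ⟦ 0 , 0 ⟧ᶜ ⟦ 0 , 0 ⟧ᶜ ⟦ 0 , 0 ⟧ᶜ

    1≈1ᶜ : 1# ≈ 1ᶜ
    1≈1ᶜ = eq (R.sym 1-homo) (R.sym 0-homo) (R.sym 0-homo) (R.sym 0-homo)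
      where open _-Raw-AlmostCommutative⟶_ morphism

    1ᶜ-identityˡ : ∀ p → 1ᶜ * p ≈ p
    1ᶜ-identityˡ (quat a b c d) = eq
      (solve 6 (λ α̂ β̂ a b c d → Quaternion.re (_⊛_ α̂ β̂ 𝟙 (quat a b c d)) := Quaternion.re (quat a b c d)) R.refl α β a b c d)
      (solve 6 (λ α̂ β̂ a b c d → Quaternion.im-i (_⊛_ α̂ β̂ 𝟙 (quat a b c d)) := Quaternion.im-i (quat a b c d)) R.refl α β a b c d)
      (solve 6 (λ α̂ β̂ a b c d → Quaternion.im-j (_⊛_ α̂ β̂ 𝟙 (quat a b c d)) := Quaternion.im-j (quat a b c d)) R.refl α β a b c d)
      (solve 6 (λ α̂ β̂ a b c d → Quaternion.im-k (_⊛_ α̂ β̂ 𝟙 (quat a b c d)) := Quaternion.im-k (quat a b c d)) R.refl α β a b c d)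

    1ᶜ-identityʳ : ∀ p → p * 1ᶜ ≈ p
    1ᶜ-identityʳ (quat a b c d) = eq
      (solve 6 (λ α̂ β̂ a b c d → Quaternion.re (_⊛_ α̂ β̂ (quat a b c d) 𝟙) := Quaternion.re (quat a b c d)) R.refl α β a b c d)
      (solve 6 (λ α̂ β̂ a b c d → Quaternion.im-i (_⊛_ α̂ β̂ (quat a b c d) 𝟙) := Quaternion.im-i (quat a b c d)) R.refl α β a b c d)
      (solve 6 (λ α̂ β̂ a b c d → Quaternion.im-j (_⊛_ α̂ β̂ (quat a b c d) 𝟙) := Quaternion.im-j (quat a b c d)) R.refl α β a b c d)
      (solve 6 (λ α̂ β̂ a b c d → Quaternion.im-k (_⊛_ α̂ β̂ (quat a b c d) 𝟙) := Quaternion.im-k (quat a b c d)) R.refl α β a b c d)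

  isRing : IsRing _≈_ _+_ _*_ -_ 0# 1#
  isRing = record
    { +-isAbelianGroup = record
      { isGroup = record
        { isMonoid = record
          { isSemigroup = record
            { isMagma = record
              { isEquivalence = ≈-isEquivalence
              ; ∙-cong = λ { (eq a b c d) (eq a′ b′ c′ d′) →
                  eq (R.+-cong a a′) (R.+-cong b b′) (R.+-cong c c′) (R.+-cong d d′) }
              }
            ; assoc = λ _ _ _ → eq (R.+-assoc _ _ _) (R.+-assoc _ _ _) (R.+-assoc _ _ _) (R.+-assoc _ _ _)
            }
          ; identity = (λ _ → eq (R.+-identityˡ _) (R.+-identityˡ _) (R.+-identityˡ _) (R.+-identityˡ _))
                     , (λ _ → eq (R.+-identityʳ _) (R.+-identityʳ _) (R.+-identityʳ _) (R.+-identityʳ _))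
          }
        ; inverse = (λ _ → eq (R.-‿inverseˡ _) (R.-‿inverseˡ _) (R.-‿inverseˡ _) (R.-‿inverseˡ _))
                  , (λ _ → eq (R.-‿inverseʳ _) (R.-‿inverseʳ _) (R.-‿inverseʳ _) (R.-‿inverseʳ _))
        ; ⁻¹-cong = λ { (eq a b c d) → eq (R.-‿cong a) (R.-‿cong b) (R.-‿cong c) (R.-‿cong d) }
        }
      ; comm = λ _ _ → eq (R.+-comm _ _) (R.+-comm _ _) (R.+-comm _ _) (R.+-comm _ _)
      }
    ; *-cong     = *-cong
    ; *-assoc    = *-assoc
    ; *-identity = (λ p → E.trans (*-cong 1≈1ᶜ E.refl) (1ᶜ-identityˡ p))
                 , (λ p → E.trans (*-cong E.refl 1≈1ᶜ) (1ᶜ-identityʳ p))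
    ; distrib    = *-distribˡ-+ , *-distribʳ-+
    }

  ring : Ring c ℓ
  ring = record { isRing = isRing }

------------------------------------------------------------------------
-- In characteristic ≠ 2 every quaternion algebra over k has the form
-- (α, β / k) with α, β ∈ k*.

record QuaternionDivisionAlgebra {c ℓ} (k : DyadicLocalField c ℓ) : Set (c ⊔ ℓ) where
  private
    module k = DyadicLocalField k
  field
    α β : k.Carrier
    α≉0 : α k.≉ k.0#
    β≉0 : β k.≉ k.0#

  open QuaternionAlgebra k.commutativeRing α β public using (ring; ι; conj; N)
  open Ring ring public

  field
    invertible : ∀ q → q ≉ 0# → ∃ λ p → (p * q ≈ 1#) × (q * p ≈ 1#)

  infix 9 _⁻¹⟨_⟩

  _⁻¹⟨_⟩ : ∀ q → q ≉ 0# → Carrier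
  q ⁻¹⟨ q≉0 ⟩ = proj₁ (invertible q q≉0)

  ν : Carrier → ℤ∞
  ν q = k.ν (N q)

  2# 4# : Carrier
  2# = 1# + 1#
  4# = 2# * 2#

  -- | p | ≤ | q |, where | q | = | N q |ₖ is a fixed real number > 1
  -- raised to the power - ν q.
  infix 4 ∣_∣≤∣_∣
  ∣_∣≤∣_∣ : Carrier → Carrier → Set
  ∣ p ∣≤∣ q ∣ = ν q ≤⁺ ν p

  𝓞 : Carrier → Set
  𝓞 q = ∣ q ∣≤∣ 1# ∣

  Pure : Carrier → Set ℓ
  Pure q = conj q ≈ - q

  infix 4 _∈_k*²
  _∈_k*² : k.Carrier → k.Carrier → Set (c ⊔ ℓ)
  x ∈ y k*² = ∃ λ z → (z k.≉ k.0#) × (x k.≈ y k.* (z k.* z))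

module _ {c ℓ} {k : DyadicLocalField c ℓ} (D : QuaternionDivisionAlgebra k) where
  private
    module D = QuaternionDivisionAlgebra D

  record SkewHermitianSpace v ℓv : Set (c ⊔ ℓ ⊔ lsuc (v ⊔ ℓv)) where
    field
      leftModule : LeftModule D.ring v ℓv

    open LeftModule leftModule public

    infixl 6 _-ᴹ_
    _-ᴹ_ : Carrierᴹ → Carrierᴹ → Carrierᴹ
    x -ᴹ y = x +ᴹ -ᴹ y

    ∑ : ∀ {n} → (Fin n → Carrierᴹ) → Carrierᴹ
    ∑ = Algebra.Definitions.RawMonoid.sum +ᴹ-rawMonoid

    lincomb : ∀ {n} → (Fin n → D.Carrier) → (Fin n → Carrierᴹ) → Carrierᴹ
    lincomb q x = ∑ (λ i → q i *ₗ x i)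

    field
      rank        : ℕ
      basis       : Fin rank → Carrierᴹ
      spanning    : ∀ x → ∃ λ q → x ≈ᴹ lincomb q basis
      independent : ∀ q → lincomb q basis ≈ᴹ 0ᴹ → ∀ i → q i D.≈ D.0#

      h             : Carrierᴹ → Carrierᴹ → D.Carrier
      h-cong        : ∀ {x x′ y y′} → x ≈ᴹ x′ → y ≈ᴹ y′ → h x y D.≈ h x′ y′
      h-+           : ∀ x y z → h (x +ᴹ y) z D.≈ h x z D.+ h y z
      h-*           : ∀ q x y → h (q *ₗ x) y D.≈ q D.* h x y
      h-skew        : ∀ x y → h x y D.≈ D.- D.conj (h y x)
      nondegenerate : ∀ x → (∀ y → h x y D.≈ D.0#) → x ≈ᴹ 0ᴹ

module _ {c ℓ v ℓv} {k : DyadicLocalField c ℓ} {D : QuaternionDivisionAlgebra k}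
         (V : SkewHermitianSpace D v ℓv) where
  private
    module D = QuaternionDivisionAlgebra D
  open SkewHermitianSpace V

  -- ⟨ a₁ ⟩ ⊥ ⋯ ⊥ ⟨ aₙ ⟩ = 𝓞 s₁ ⊥ ⋯ ⊥ 𝓞 sₙ inside V, not necessarily of
  -- full rank; the condition aᵢ ≉ 0 says that h is nondegenerate on its
  -- span.
  record DiagonalLattice (n : ℕ) : Set (c ⊔ ℓ ⊔ v) where
    field
      a          : Fin n → D.Carrier
      a-pure     : ∀ i → D.Pure (a i)
      a≉0        : ∀ i → a i D.≉ D.0#
      s          : Fin n → Carrierᴹ
      h-diagonal : ∀ i → h (s i) (s i) D.≈ a i
      orthogonal : ∀ i j → ¬ i ≡ j → h (s i) (s j) D.≈ D.0#

  record SimpleRotation : Set (c ⊔ ℓ ⊔ v) where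
    field
      s   : Carrierᴹ
      σ   : D.Carrier
      σ≉0 : σ D.≉ D.0#
      σ-σ̄ : σ D.- D.conj σ D.≈ h s s

    apply : Carrierᴹ → Carrierᴹ
    apply x = x -ᴹ (h x s D.* σ D.⁻¹⟨ σ≉0 ⟩) *ₗ s

module _ {c ℓ v ℓv} {k : DyadicLocalField c ℓ} {D : QuaternionDivisionAlgebra k}
         {V : SkewHermitianSpace D v ℓv} where
  private
    module D = QuaternionDivisionAlgebra D
  open SkewHermitianSpace V

  infix 4 _∈_ _∈D_ _⊆_ _∈𝓤⁺_ _∈𝓑_

  _∈_ : ∀ {n} → Carrierᴹ → DiagonalLattice V n → Set (c ⊔ ℓv)
  x ∈ Λ = ∃ λ q → (∀ i → D.𝓞 (q i)) × (x ≈ᴹ lincomb q (DiagonalLattice.s Λ))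

  _∈D_ : ∀ {n} → Carrierᴹ → DiagonalLattice V n → Set (c ⊔ ℓv)
  x ∈D Λ = ∃ λ q → x ≈ᴹ lincomb q (DiagonalLattice.s Λ)

  _⊆_ : ∀ {m n} → DiagonalLattice V m → DiagonalLattice V n → Set (c ⊔ v ⊔ ℓv)
  Λ ⊆ Λ′ = ∀ x → x ∈ Λ → x ∈ Λ′

  Ascending : ∀ {n} → DiagonalLattice V (suc n) → Set
  Ascending {n} Λ = ∀ (i : Fin n) → D.ν (a (inject₁ i)) ≤⁺ D.ν (a (suc i))
    where open DiagonalLattice Λ

  -- min ∅ = ∞ in rank 1
  μ : ∀ {n} → DiagonalLattice V (suc n) → ℤ∞
  μ {n} Λ = foldr _⊓∞_ ⊤⁺ (λ (i : Fin n) → D.ν (a (suc i)) -∞ D.ν (a (inject₁ i)))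
    where open DiagonalLattice Λ

  -- φ restricts to an isometry of the skew-hermitian space DΛ with
  -- φ(Λ) = Λ.  For Λ of full rank, DΛ = V.
  record 𝓤⁺ {n} (Λ : DiagonalLattice V n) (φ : Carrierᴹ → Carrierᴹ)
            : Set (c ⊔ ℓ ⊔ v ⊔ ℓv) where
    field
      stable    : ∀ x → x ∈D Λ → φ x ∈D Λ
      φ-cong    : ∀ x y → x ∈D Λ → y ∈D Λ → x ≈ᴹ y → φ x ≈ᴹ φ y
      φ-+       : ∀ x y → x ∈D Λ → y ∈D Λ → φ (x +ᴹ y) ≈ᴹ φ x +ᴹ φ y
      φ-*       : ∀ q x → x ∈D Λ → φ (q *ₗ x) ≈ᴹ q *ₗ φ x
      isometric : ∀ x y → x ∈D Λ → y ∈D Λ → h (φ x) (φ y) D.≈ h x y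
      φΛ⊆Λ      : ∀ x → x ∈ Λ → φ x ∈ Λ
      Λ⊆φΛ      : ∀ y → y ∈ Λ → ∃ λ x → (x ∈ Λ) × (φ x ≈ᴹ y)

  -- (s ; σ) is a simple rotation of the space DΛ, so s must lie in DΛ.
  _∈𝓤⁺_ : ∀ {n} → SimpleRotation V → DiagonalLattice V n → Set (c ⊔ ℓ ⊔ v ⊔ ℓv)
  ρ ∈𝓤⁺ Λ = (s ∈D Λ) × 𝓤⁺ Λ apply
    where open SimpleRotation ρ

  record _∈𝓑_ {n} (ρ : SimpleRotation V) (Λ : DiagonalLattice V n)
              : Set (c ⊔ ℓ ⊔ v ⊔ ℓv) where
    private
      module Λ = DiagonalLattice Λ
      module ρ = SimpleRotation ρ
    field
      ρ∈𝓤⁺   : ρ ∈𝓤⁺ Λ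
      m      : Fin n
      r      : D.Carrier
      r∈𝓞    : D.𝓞 r
      |1-r|≥ : D.∣ D.2# ∣≤∣ D.1# D.- r ∣
      -- only the values at indices l > m are used
      λₗ     : Fin n → D.Carrier
      λₗ∈𝓞   : ∀ l → m Fin.< l → D.𝓞 (λₗ l)

    s₀ : Carrierᴹ
    s₀ = ∑ (λ l → if does (m Finₚ.<? l) then λₗ l *ₗ Λ.s l else 0ᴹ)

    field
      s-eq : ρ.s ≈ᴹ (D.1# D.- r) *ₗ Λ.s m -ᴹ s₀
      σ-eq : ρ.σ D.≈ Λ.a m D.* (D.1# D.- D.conj r)

{-# OPTIONS --safe #-}
module Submission where

-- Replace s_{m+t} by w = s_{m+t} + ∑_{l > m+t} κ_l s_l, where
-- λ_{m+t} κ_l = λ_l and κ_l ∈ 𝓞, and let Λ′ be spanned by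
-- s_m, …, s_{m+t-1}, w.  Then s ∈ DΛ′, so the rotation preserves DΛ′ and
-- therefore Λ′ = DΛ′ ∩ Λ.  It remains to compare b = h(w, w) with
-- a = a_{m+t}.  Here b = a + c with ν(c) > ν(a) + ν(4), and
-- N(b) = N(a) + N(c) + T(a c̄).  In the division algebra D the trace
-- satisfies ν(q) ≤ 2 ν(T q), so that N(b) / N(a) ∈ 1 + 4𝔭, and all elements
-- of 1 + 4𝔭 are squares of units.  Both the bound on the trace and the
-- local square theorem come from solving y = γ + y² in k for ν(γ) > 0.

open import Defs
open import Algebra.Bundles using (CommutativeMonoid)
import Algebra.Module.Properties.LeftModule
import Algebra.Properties.AbelianGroup
import Algebra.Properties.CommutativeMonoid.Sum
import Algebra.Properties.CommutativeSemigroup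
import Algebra.Properties.Ring
import Algebra.Properties.Semiring.Sum
open import Data.Bool.Base using (true; false; if_then_else_)
open import Data.Empty using (⊥-elim)
open import Data.Fin.Base using (Fin; zero; suc; toℕ; inject₁; punchIn; fromℕ; fromℕ<) renaming (_<_ to _<ᶠ_; _≤_ to _≤ᶠ_)
import Data.Fin.Properties as Finₚ
open import Data.Integer.Base as ℤ using (ℤ; +_; -[1+_]; 0ℤ; 1ℤ)
import Data.Integer.Properties as ℤₚ
open import Data.Nat.Base as ℕ using (ℕ; zero; suc)
import Data.Nat.Properties as ℕₚ
open import Data.Product.Base using (∃; _×_; _,_; proj₁; proj₂)
open import Data.Sum.Base using (_⊎_; inj₁; inj₂; [_,_]′)
open import Data.Vec.Functional using (foldr; removeAt)
open import Function.Base using (_∘_)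
open import Relation.Binary.Construct.Add.Supremum.NonStrict ℤ._≤_ using ([_]; _≤⊤⁺; ≤⁺-trans; ≤⁺-total; ≤⁺-reflexive-≡; ≤⁺-antisym-≡)
open import Relation.Binary.Construct.Add.Supremum.Strict ℤ._<_ using ([_]; [_]<⊤⁺; <⁺-transʳ; <⁺-transˡ)
open import Relation.Binary.PropositionalEquality as ≡ using (_≡_; _≢_; refl; cong; cong₂; subst; subst₂)
import Relation.Binary.Reasoning.Setoid
open import Relation.Nullary.Construct.Add.Supremum using (⊤⁺; [_]; []-injective)
open import Relation.Nullary.Decidable using (dec-true; dec-false)
open import Relation.Nullary.Decidable.Core using (Dec; yes; no; does)
open import Relation.Nullary.Negation.Core using (¬_; contradiction)

-- The ordered monoid ℤ ∪ {∞}

-- The constant ν(4) is matched to two tools. On scalars `N` is squaring, so ν(4) in D is twice the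
-- value of 4 in k. The trace bound costs a factor of two, so ν(c) > ν(a) + ν(4) yields a trace term
-- T(a c̄) / N(a) whose value in k exceeds that of 4, which is the threshold of the local square
-- theorem; N(c) clears it with room to spare. The quotients κ_l stand to the right of λ_{m+t}
-- because scalars act on `w` from the left. The condition on |λ_{m+t}| is precisely their
-- integrality, which serves twice: it keeps Λ′ inside Λ, and it keeps c = ∑ κ_l a_l κ̄_l from
-- falling below the gap. If λ_{m+t} = 0, all later λ_l vanish and κ_l = 0 will do. Λ′ = DΛ′ ∩ Λ
-- holds because the transition matrix differs from the identity only in the tail of one row.

private
  variable
    x y z z′ : ℤ∞

≤∞-refl : x ≤⁺ x
≤∞-refl = ≤⁺-reflexive-≡ ℤₚ.≤-reflexive refl

≤∞-reflexive : x ≡ y → x ≤⁺ y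
≤∞-reflexive = ≤⁺-reflexive-≡ ℤₚ.≤-reflexive

≤∞-antisym : x ≤⁺ y → y ≤⁺ x → x ≡ y
≤∞-antisym = ≤⁺-antisym-≡ ℤₚ.≤-antisym

≤∞-trans : x ≤⁺ y → y ≤⁺ z → x ≤⁺ z
≤∞-trans = ≤⁺-trans ℤₚ.≤-trans

≤∞-total : ∀ x y → x ≤⁺ y ⊎ y ≤⁺ x
≤∞-total = ≤⁺-total ℤₚ.≤-total

≤-<∞-trans : x ≤⁺ y → y <⁺ z → x <⁺ z
≤-<∞-trans = <⁺-transʳ ℤₚ.≤-<-trans

<-≤∞-trans : x <⁺ y → y ≤⁺ z → x <⁺ z
<-≤∞-trans = <⁺-transˡ ℤₚ.<-≤-trans

≤∞⊎>∞ : ∀ x y → x ≤⁺ y ⊎ y <⁺ x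
≤∞⊎>∞ x      ⊤⁺    = inj₁ (x ≤⊤⁺)
≤∞⊎>∞ ⊤⁺     [ j ] = inj₂ [ j ]<⊤⁺
≤∞⊎>∞ [ i ]  [ j ] with i ℤₚ.≤? j
... | yes i≤j = inj₁ [ i≤j ]
... | no  i≰j = inj₂ [ ℤₚ.≰⇒> i≰j ]

<∞⇒≱∞ : x <⁺ y → ¬ (y ≤⁺ x)
<∞⇒≱∞ [ i<j ] [ j≤i ] = ℤₚ.<⇒≱ i<j j≤i

⊤⁺≮∞ : ¬ (⊤⁺ <⁺ x)
⊤⁺≮∞ ()

<∞⇒≤∞ : x <⁺ y → x ≤⁺ y
<∞⇒≤∞ [ i<j ]    = [ ℤₚ.<⇒≤ i<j ]
<∞⇒≤∞ [ i ]<⊤⁺   = [ i ] ≤⊤⁺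

0<∞⇒1≤∞ : [ 0ℤ ] <⁺ x → [ 1ℤ ] ≤⁺ x
0<∞⇒1≤∞ [ 0<i ]  = [ ℤₚ.i<j⇒suc[i]≤j 0<i ]
0<∞⇒1≤∞ [ _ ]<⊤⁺ = _ ≤⊤⁺

1≤∞⇒0<∞ : [ 1ℤ ] ≤⁺ x → [ 0ℤ ] <⁺ x
1≤∞⇒0<∞ = <-≤∞-trans [ ℤ.+<+ ℕ.z<s ]

⊓∞-glb : z ≤⁺ x → z ≤⁺ y → z ≤⁺ x ⊓∞ y
⊓∞-glb {x = [ _ ]} {[ _ ]} [ p ] [ q ] = [ ℤₚ.⊓-glb p q ]
⊓∞-glb {x = [ _ ]} {⊤⁺}    p     q     = p
⊓∞-glb {x = ⊤⁺}            p     q     = q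

⊓∞-≤ˡ : ∀ x y → x ⊓∞ y ≤⁺ x
⊓∞-≤ˡ [ i ] [ j ] = [ ℤₚ.i⊓j≤i i j ]
⊓∞-≤ˡ [ i ] ⊤⁺    = ≤∞-refl
⊓∞-≤ˡ ⊤⁺    y     = y ≤⊤⁺

⊓∞-≤ʳ : ∀ x y → x ⊓∞ y ≤⁺ y
⊓∞-≤ʳ [ i ] [ j ] = [ ℤₚ.i⊓j≤j i j ]
⊓∞-≤ʳ [ i ] ⊤⁺    = [ i ] ≤⊤⁺
⊓∞-≤ʳ ⊤⁺    y     = ≤∞-refl

+∞-comm : ∀ x y → x +∞ y ≡ y +∞ x
+∞-comm [ i ] [ j ] = cong [_] (ℤₚ.+-comm i j)
+∞-comm [ i ] ⊤⁺    = refl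
+∞-comm ⊤⁺    [ j ] = refl
+∞-comm ⊤⁺    ⊤⁺    = refl

+∞-assoc : ∀ x y z → (x +∞ y) +∞ z ≡ x +∞ (y +∞ z)
+∞-assoc [ i ] [ j ] [ l ] = cong [_] (ℤₚ.+-assoc i j l)
+∞-assoc [ i ] [ j ] ⊤⁺    = refl
+∞-assoc [ i ] ⊤⁺    z     = refl
+∞-assoc ⊤⁺    y     z     = refl

+∞-identityˡ : ∀ x → [ 0ℤ ] +∞ x ≡ x
+∞-identityˡ [ i ] = cong [_] (ℤₚ.+-identityˡ i)
+∞-identityˡ ⊤⁺    = refl

+∞-identityʳ : ∀ x → x +∞ [ 0ℤ ] ≡ x
+∞-identityʳ x = ≡.trans (+∞-comm x _) (+∞-identityˡ x)

+∞-interchange : ∀ x y → (x +∞ y) +∞ (x +∞ y) ≡ x +∞ (x +∞ (y +∞ y))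
+∞-interchange x y = begin
  (x +∞ y) +∞ (x +∞ y)  ≡⟨ +∞-assoc x y _ ⟩
  x +∞ (y +∞ (x +∞ y))  ≡⟨ cong (x +∞_) (≡.sym (+∞-assoc y x y)) ⟩
  x +∞ ((y +∞ x) +∞ y)  ≡⟨ cong (λ u → x +∞ (u +∞ y)) (+∞-comm y x) ⟩
  x +∞ ((x +∞ y) +∞ y)  ≡⟨ cong (x +∞_) (+∞-assoc x y y) ⟩
  x +∞ (x +∞ (y +∞ y))  ∎
  where open ≡.≡-Reasoning

+∞-mono-≤ : x ≤⁺ y → z ≤⁺ z′ → x +∞ z ≤⁺ y +∞ z′
+∞-mono-≤ [ p ]    [ q ]    = [ ℤₚ.+-mono-≤ p q ]
+∞-mono-≤ [ p ]    (_ ≤⊤⁺)  = _ ≤⊤⁺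
+∞-mono-≤ (_ ≤⊤⁺)  q        = _ ≤⊤⁺

+∞-mono-< : x <⁺ y → z <⁺ z′ → x +∞ z <⁺ y +∞ z′
+∞-mono-< [ p ]     [ q ]     = [ ℤₚ.+-mono-< p q ]
+∞-mono-< [ p ]     [ _ ]<⊤⁺  = [ _ ]<⊤⁺
+∞-mono-< [ _ ]<⊤⁺  [ _ ]     = [ _ ]<⊤⁺
+∞-mono-< [ _ ]<⊤⁺  [ _ ]<⊤⁺  = [ _ ]<⊤⁺

-- The fixed summand is finite: adding ∞ would collapse both sides.
+∞-monoʳ-< : ∀ i → x <⁺ y → [ i ] +∞ x <⁺ [ i ] +∞ y
+∞-monoʳ-< i [ p ]     = [ ℤₚ.+-monoʳ-< i p ]
+∞-monoʳ-< i [ _ ]<⊤⁺  = [ _ ]<⊤⁺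

+∞-cancelʳ-< : ∀ z → x +∞ z <⁺ y +∞ z → x <⁺ y
+∞-cancelʳ-< {x} {y} z x+z<y+z with ≤∞⊎>∞ y x
... | inj₁ y≤x = contradiction (+∞-mono-≤ y≤x ≤∞-refl) (<∞⇒≱∞ x+z<y+z)
... | inj₂ x<y = x<y

double-cancel-< : x +∞ x <⁺ y +∞ y → x <⁺ y
double-cancel-< {x} {y} 2x<2y with ≤∞⊎>∞ y x
... | inj₁ y≤x = contradiction (+∞-mono-≤ y≤x y≤x) (<∞⇒≱∞ 2x<2y)
... | inj₂ x<y = x<y

double-cancel-≤ : x +∞ x ≤⁺ y +∞ y → x ≤⁺ y
double-cancel-≤ {x} {y} 2x≤2y with ≤∞⊎>∞ x y
... | inj₁ x≤y = x≤y
... | inj₂ y<x = contradiction 2x≤2y (<∞⇒≱∞ (+∞-mono-< y<x y<x))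

double-injective : x +∞ x ≡ y +∞ y → x ≡ y
double-injective 2x≡2y = ≤∞-antisym
  (double-cancel-≤ (≤∞-reflexive 2x≡2y)) (double-cancel-≤ (≤∞-reflexive (≡.sym 2x≡2y)))

-- `μ` speaks of differences, while all later estimates are additive.
<-∞⇒+∞< : ∀ i → x <⁺ y -∞ [ i ] → [ i ] +∞ x <⁺ y
<-∞⇒+∞< {[ j ]} {[ l ]} i [ p ] = [ subst₂ ℤ._<_ (ℤₚ.+-comm j i) (//-rightDividesˡ i l) (ℤₚ.+-monoˡ-< i p) ]
  where open Algebra.Properties.AbelianGroup ℤₚ.+-0-abelianGroup using (//-rightDividesˡ)
<-∞⇒+∞< {[ j ]} {⊤⁺}    i _     = [ _ ]<⊤⁺

finite : x <⁺ y → ∃ λ i → x ≡ [ i ]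
finite [ _ ]    = _ , refl
finite [ _ ]<⊤⁺ = _ , refl

i≤∣i∣ : ∀ i → i ℤ.≤ + ℤ.∣ i ∣
i≤∣i∣ (+ _)     = ℤₚ.≤-refl
i≤∣i∣ -[1+ _ ]  = ℤ.-≤+

-- Hensel's lemma for y = γ + y², and the local square theorem

module FieldProperties {c ℓ} (k : DyadicLocalField c ℓ) where

  open DyadicLocalField k renaming (refl to ≈-refl)
  open Algebra.Properties.AbelianGroup +-abelianGroup using (⁻¹-involutive; x∙y⁻¹≈ε⇒x≈y)
  -- The quaternion parameters are irrelevant to the solver.
  open QuaternionAlgebra.Solver commutativeRing 0# 0# using (solve; _:=_; _:+_; _:*_; _:-_; :-_)
  open Relation.Binary.Reasoning.Setoid setoid

  -- Equality in k is an abstract setoid relation, but `ν` can be inspected, and it is ∞ only at 0.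
  ≈0? : ∀ a → Dec (a ≈ 0#)
  ≈0? a with ν a in eq
  ... | ⊤⁺    = yes (ν-∞ a eq)
  ... | [ i ] = no λ a≈0 → contradiction (≡.trans (≡.sym eq) (≡.trans (ν-cong a≈0) ν-0)) λ ()

  ν-finite : ∀ {a} → a ≉ 0# → ∃ λ i → ν a ≡ [ i ]
  ν-finite {a} a≉0 with ν a in eq
  ... | ⊤⁺    = contradiction (ν-∞ a eq) a≉0
  ... | [ i ] = i , refl

  ≉0 : ∀ {a i} → ν a ≡ [ i ] → a ≉ 0#
  ≉0 νa≡i a≈0 = contradiction (≡.trans (≡.sym νa≡i) (≡.trans (ν-cong a≈0) ν-0)) λ ()

  1≉0 : 1# ≉ 0#
  1≉0 1≈0 = characteristic-0 0 (trans (+-identityʳ 1#) 1≈0)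

  ν-1 : ν 1# ≡ [ 0ℤ ]
  ν-1 with ν-finite 1≉0
  ... | i , ν1≡i = ≡.trans ν1≡i (cong [_] (ℤ-identityʳ-unique i i (≡.sym ([]-injective
    (subst (λ u → u ≡ u +∞ u) ν1≡i (≡.trans (ν-cong (sym (*-identityˡ 1#))) (ν-* 1# 1#)))))))
    where
    open Algebra.Properties.AbelianGroup ℤₚ.+-0-abelianGroup using () renaming (identityʳ-unique to ℤ-identityʳ-unique)

  -- Squaring forgets the sign, and doubling is injective on ℤ ∪ {∞}.
  ν-neg : ∀ a → ν (- a) ≡ ν a
  ν-neg a = double-injective (≡.trans (≡.sym (ν-* (- a) (- a)))
    (≡.trans (ν-cong (solve 1 (λ a → (:- a) :* (:- a) := a :* a) ≈-refl a)) (ν-* a a)))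

  ν-+-≥ : ∀ {e} a b → e ≤⁺ ν a → e ≤⁺ ν b → e ≤⁺ ν (a + b)
  ν-+-≥ a b p q = ≤∞-trans (⊓∞-glb p q) (ν-+ a b)

  ν-+-> : ∀ {e} a b → e <⁺ ν a → e <⁺ ν b → e <⁺ ν (a + b)
  ν-+-> a b p q with ≤∞-total (ν a) (ν b)
  ... | inj₁ νa≤νb = <-≤∞-trans p (ν-+-≥ a b ≤∞-refl νa≤νb)
  ... | inj₂ νb≤νa = <-≤∞-trans q (ν-+-≥ a b νb≤νa ≤∞-refl)

  ν-sub-≥ : ∀ {e} a b → e ≤⁺ ν a → e ≤⁺ ν b → e ≤⁺ ν (a - b)
  ν-sub-≥ a b p q = ν-+-≥ a (- b) p (≤∞-trans q (≤∞-reflexive (≡.sym (ν-neg b))))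

  -- Otherwise 1 = (1 + u) - u would have positive value.
  ν-1+ : ∀ u → [ 0ℤ ] <⁺ ν u → ν (1# + u) ≡ [ 0ℤ ]
  ν-1+ u 0<νu with ≤∞⊎>∞ (ν (1# + u)) [ 0ℤ ]
  ... | inj₁ ν≤0 = ≤∞-antisym ν≤0 (ν-+-≥ 1# u (≤∞-reflexive (≡.sym ν-1)) (<∞⇒≤∞ 0<νu))
  ... | inj₂ 0<ν = contradiction (≤∞-reflexive ν-1) (<∞⇒≱∞ (subst ([ 0ℤ ] <⁺_)
    (ν-cong (solve 2 (λ o u → (o :+ u) :+ (:- u) := o) ≈-refl 1# u))
    (ν-+-> (1# + u) (- u) 0<ν (subst ([ 0ℤ ] <⁺_) (≡.sym (ν-neg u)) 0<νu))))

  -- This is how an equation passes to a limit: its two sides need only agree to every finite order.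
  ν-unbounded⇒≈0 : ∀ a → (∀ (e : ℕ) → [ + e ] ≤⁺ ν a) → a ≈ 0#
  ν-unbounded⇒≈0 a unbounded with ν a in eq
  ... | ⊤⁺    = ν-∞ a eq
  ... | [ i ] with unbounded (suc ℤ.∣ i ∣)
  ...   | [ 1+∣i∣≤i ] = contradiction (ℤₚ.≤-trans 1+∣i∣≤i (i≤∣i∣ i)) (ℤₚ.<⇒≱ (ℤ.+<+ ℕₚ.≤-refl))

  private
    difference-of-squares : ∀ γ a b → (γ + a * a) - (γ + b * b) ≈ (a + b) * (a - b)
    difference-of-squares = solve 3 (λ γ a b → (γ :+ a :* a) :- (γ :+ b :* b) := (a :+ b) :* (a :- b)) ≈-refl

    telescope : ∀ a b c → (a - b) + (b - c) ≈ a - c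
    telescope = solve 3 (λ a b c → (a :- b) :+ (b :- c) := a :- c) ≈-refl

    telescope′ : ∀ a b c → (a - b) - (c - b) ≈ a - c
    telescope′ = solve 3 (λ a b c → (a :- b) :- (c :- b) := a :- c) ≈-refl

    a-[a-b] : ∀ a b → a - (a - b) ≈ b
    a-[a-b] = solve 2 (λ a b → a :- (a :- b) := b) ≈-refl

    -- Expresses the failure of `r` to be a fixed point through the errors of two consecutive
    -- iterates, `a` and `γ + a * a`.
    defect : ∀ a r γ → (a - r) * (a + r) - ((γ + a * a) - r) ≈ r - (γ + r * r)
    defect = solve 3 (λ a r γ → (a :- r) :* (a :+ r) :- ((γ :+ a :* a) :- r) := r :- (γ :+ r :* r)) ≈-refl

    *-swap : ∀ p w b → p * (w * b) ≈ w * (p * b)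
    *-swap = solve 3 (λ p w b → p :* (w :* b) := w :* (p :* b)) ≈-refl

    -- Here and in `expand-square` the variable `o` stands for 1; the unit laws remove it
    -- afterwards.
    expand-four : ∀ o p → (o + o) * (o + o) * p ≈
      (o * (o * p) + o * (o * p)) + (o * (o * p) + o * (o * p))
    expand-four = solve 2 (λ o p → (o :+ o) :* (o :+ o) :* p :=
      (o :* (o :* p) :+ o :* (o :* p)) :+ (o :* (o :* p) :+ o :* (o :* p))) ≈-refl

    expand-square : ∀ o y → let d = o * y - y * y in
      (o - (y + y)) * (o - (y + y)) ≈ o * o - ((d + d) + (d + d))
    expand-square = solve 2 (λ o y → let d = o :* y :- y :* y in
      (o :- (y :+ y)) :* (o :- (y :+ y)) := o :* o :- ((d :+ d) :+ (d :+ d))) ≈-refl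

    a+b-b : ∀ a b → (a + b) - b ≈ a
    a+b-b = solve 2 (λ a b → (a :+ b) :- b := a) ≈-refl

    distribute : ∀ a o f γ → a * (o - f * γ) ≈ a * o - (a * f) * γ
    distribute = solve 4 (λ a o f γ → a :* (o :- f :* γ) := a :* o :- (a :* f) :* γ) ≈-refl

  -- y ↦ γ + y² is a contraction of the maximal ideal.
  module Quadratic (γ : Carrier) (0<νγ : [ 0ℤ ] <⁺ ν γ) where

    approx : ℕ → Carrier
    approx zero    = 0#
    approx (suc i) = γ + approx i * approx i

    1≤approx : ∀ i → [ 1ℤ ] ≤⁺ ν (approx i)
    1≤approx zero    = subst ([ 1ℤ ] ≤⁺_) (≡.sym ν-0) (_ ≤⊤⁺)
    1≤approx (suc i) = ν-+-≥ γ _ (0<∞⇒1≤∞ 0<νγ) (subst ([ 1ℤ ] ≤⁺_) (≡.sym (ν-* _ _))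
      (≤∞-trans [ ℤ.+≤+ (ℕ.s≤s ℕ.z≤n) ] (+∞-mono-≤ (1≤approx i) (1≤approx i))))

    -- Passing to the next pair of iterates multiplies their difference by their sum, of value at
    -- least 1, so one order is gained each time.
    step : ∀ i → [ + i ] ≤⁺ ν (approx (suc i) - approx i)
    step zero    = ν-sub-≥ _ _ (≤∞-trans [ ℤ.+≤+ ℕ.z≤n ] (1≤approx 1)) (≤∞-trans [ ℤ.+≤+ ℕ.z≤n ] (1≤approx 0))
    step (suc i) = subst ([ + suc i ] ≤⁺_) (≡.sym (≡.trans (ν-cong
        (difference-of-squares γ (approx (suc i)) (approx i))) (ν-* _ _)))
      (+∞-mono-≤ (ν-+-≥ _ _ (1≤approx (suc i)) (1≤approx i)) (step i))

    steps : ∀ i j → [ + i ] ≤⁺ ν (approx (j ℕ.+ i) - approx i)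
    steps i zero    = subst ([ + i ] ≤⁺_) (≡.sym (≡.trans (ν-cong (-‿inverseʳ _)) ν-0)) (_ ≤⊤⁺)
    steps i (suc j) = subst ([ + i ] ≤⁺_)
      (ν-cong (telescope (approx (suc j ℕ.+ i)) (approx (j ℕ.+ i)) (approx i)))
      (ν-+-≥ _ _ (≤∞-trans [ ℤ.+≤+ (ℕₚ.m≤n+m i j) ] (step (j ℕ.+ i))) (steps i j))

    approx-Cauchy : Cauchy approx
    -- Both indices are compared with the iterate number `∣ e ∣`; the absolute value gives a usable
    -- index for negative `e` too.
    approx-Cauchy e = ℤ.∣ e ∣ , λ i j M≤i M≤j →
      subst ([ e ] ≤⁺_) (ν-cong (telescope′ (approx i) (approx ℤ.∣ e ∣) (approx j)))
        (ν-sub-≥ _ _ (close i M≤i) (close j M≤j))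
      where
      close : ∀ i → ℤ.∣ e ∣ ℕ.≤ i → [ e ] ≤⁺ ν (approx i - approx ℤ.∣ e ∣)
      close i M≤i = ≤∞-trans [ i≤∣i∣ e ]
        (subst (λ u → [ + ℤ.∣ e ∣ ] ≤⁺ ν (approx u - approx ℤ.∣ e ∣)) (ℕₚ.m∸n+n≡m M≤i)
          (steps ℤ.∣ e ∣ (i ℕ.∸ ℤ.∣ e ∣)))

    limit-spec : ∀ {r} → approx ⟶ r → [ 1ℤ ] ≤⁺ ν r × r ≈ γ + r * r
    limit-spec {r} approx⟶r = 1≤r , x∙y⁻¹≈ε⇒x≈y _ _ (ν-unbounded⇒≈0 _ bound)
      where
      1≤r : [ 1ℤ ] ≤⁺ ν r
      1≤r with approx⟶r 1ℤ
      ... | M , close = subst ([ 1ℤ ] ≤⁺_) (ν-cong (a-[a-b] (approx M) r))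
        (ν-sub-≥ _ _ (1≤approx M) (close M ℕₚ.≤-refl))

      bound : ∀ (e : ℕ) → [ + e ] ≤⁺ ν (r - (γ + r * r))
      bound e with approx⟶r (+ e)
      ... | M , close = subst ([ + e ] ≤⁺_) (ν-cong (defect (approx M) r γ))
        (ν-sub-≥ _ _
          (subst ([ + e ] ≤⁺_) (≡.sym (ν-* _ _)) (≤∞-trans (≤∞-reflexive (≡.sym (+∞-identityʳ _)))
            (+∞-mono-≤ (close M ℕₚ.≤-refl)
              (≤∞-trans [ ℤ.+≤+ ℕ.z≤n ] (ν-+-≥ _ _ (1≤approx M) 1≤r)))))
          (close (suc M) (ℕₚ.n≤1+n M)))

  quadratic-root : ∀ γ → [ 0ℤ ] <⁺ ν γ → ∃ λ r → [ 1ℤ ] ≤⁺ ν r × r ≈ γ + r * r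
  quadratic-root γ 0<νγ = _ , limit-spec (proj₂ (complete approx approx-Cauchy))
    where open Quadratic γ 0<νγ

  -- Values of 2 and 4, and square roots of 1 - 4γ.

  *-inverse-cancel : ∀ {a b} → a * b ≈ 1# → ∀ w → a * (w * b) ≈ w
  *-inverse-cancel {a} {b} ab≈1 w = trans (*-swap a w b) (trans (*-congˡ ab≈1) (*-identityʳ w))

  two four : Carrier
  two  = 1# + 1#
  four = two * two

  two≉0 : two ≉ 0#
  two≉0 two≈0 = characteristic-0 1 (trans (+-congˡ (+-identityʳ 1#)) two≈0)

  0<ν-double : ∀ a → [ 0ℤ ] ≤⁺ ν a → [ 0ℤ ] <⁺ ν (a + a)
  0<ν-double a 0≤νa = subst ([ 0ℤ ] <⁺_)
    (≡.trans (≡.sym (ν-* two a)) (ν-cong (trans (distribʳ a 1# 1#) (+-cong (*-identityˡ a) (*-identityˡ a)))))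
    (<-≤∞-trans residueField-char-2 (≤∞-trans (≤∞-reflexive (≡.sym (+∞-identityʳ _)))
      (+∞-mono-≤ ≤∞-refl 0≤νa)))

  0≤ν-four : [ 0ℤ ] ≤⁺ ν four
  0≤ν-four = subst ([ 0ℤ ] ≤⁺_) (≡.sym (ν-* two two))
    (+∞-mono-≤ (<∞⇒≤∞ residueField-char-2) (<∞⇒≤∞ residueField-char-2))

  *-≉0 : ∀ {a b} → a ≉ 0# → b ≉ 0# → a * b ≉ 0#
  *-≉0 {a} {b} a≉0 b≉0 with ν-finite a≉0 | ν-finite b≉0
  ... | i , p | j , q = ≉0 (≡.trans (ν-* a b) (cong₂ _+∞_ p q))

  four-* : ∀ p → four * p ≈ (p + p) + (p + p)
  four-* p = trans (expand-four 1# p) (+-cong (+-cong u≈p u≈p) (+-cong u≈p u≈p))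
    where
    u≈p : 1# * (1# * p) ≈ p
    u≈p = trans (*-identityˡ _) (*-identityˡ p)

  -- Completing the square gives (1 - 2y)² = 1 - 4(y - y²), and the equation for `y` says that y -
  -- y² = γ.
  square-of-root : ∀ γ y → y ≈ γ + y * y → (1# - (y + y)) * (1# - (y + y)) ≈ 1# - four * γ
  square-of-root γ y y-eq = begin
    (1# - (y + y)) * (1# - (y + y))  ≈⟨ expand-square 1# y ⟩
    1# * 1# - ((d + d) + (d + d))    ≈⟨ +-cong (*-identityˡ 1#) (-‿cong (+-cong (+-cong d≈γ d≈γ) (+-cong d≈γ d≈γ))) ⟩
    1# - ((γ + γ) + (γ + γ))         ≈⟨ +-congˡ (-‿cong (sym (four-* γ))) ⟩
    1# - four * γ                    ∎
    where
    d : Carrier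
    d = 1# * y - y * y
    d≈γ : d ≈ γ
    d≈γ = begin
      1# * y - y * y         ≈⟨ +-congʳ (trans (*-identityˡ y) y-eq) ⟩
      (γ + y * y) - y * y    ≈⟨ a+b-b γ (y * y) ⟩
      γ                      ∎

  ν-*-< : ∀ {a b} → a ≉ 0# → [ 0ℤ ] <⁺ ν b → ν a <⁺ ν (a * b)
  ν-*-< {a} {b} a≉0 0<νb with ν-finite a≉0
  ... | i , νa≡i = subst₂ _<⁺_ (≡.trans (+∞-identityʳ [ i ]) (≡.sym νa≡i))
    (≡.trans (cong (_+∞ ν b) (≡.sym νa≡i)) (≡.sym (ν-* a b))) (+∞-monoʳ-< i 0<νb)

  -- Local square theorem.  The square root of 1 + w/a is 1 - 2y, where
  -- y = y² - w/4a.
  square-perturbation : ∀ a w → a ≉ 0# → ν a +∞ ν four <⁺ ν w →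
    ∃ λ z → ν z ≡ [ 0ℤ ] × a + w ≈ a * (z * z)
  square-perturbation a w a≉0 νa+ν4<νw = from-inverse (inverse (a * four) (*-≉0 a≉0 (*-≉0 two≉0 two≉0)))
    where
    -- `γ` is -w/4a, but it enters only through this equation.
    module _ (γ : Carrier) (4aγ≈-w : (a * four) * γ ≈ - w) where
      0<νγ : [ 0ℤ ] <⁺ ν γ
      0<νγ = +∞-cancelʳ-< (ν (a * four)) (subst₂ _<⁺_
        (≡.trans (≡.sym (ν-* a four)) (≡.sym (+∞-identityˡ _)))
        (≡.trans (≡.sym (ν-neg w)) (≡.trans (ν-cong (sym 4aγ≈-w)) (≡.trans (ν-* _ γ) (+∞-comm _ (ν γ)))))
        νa+ν4<νw)

      from-root : (∃ λ y → [ 1ℤ ] ≤⁺ ν y × y ≈ γ + y * y) → ∃ λ z → ν z ≡ [ 0ℤ ] × a + w ≈ a * (z * z)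
      from-root (y , 1≤y , y-eq) = 1# - (y + y) , ν-z , sym (begin
        a * ((1# - (y + y)) * (1# - (y + y)))  ≈⟨ *-congˡ (square-of-root γ y y-eq) ⟩
        a * (1# - four * γ)                    ≈⟨ distribute a 1# four γ ⟩
        a * 1# - (a * four) * γ                ≈⟨ +-cong (*-identityʳ a) (-‿cong 4aγ≈-w) ⟩
        a - - w                                ≈⟨ +-congˡ (⁻¹-involutive w) ⟩
        a + w                                  ∎)
        where
        ν-z : ν (1# - (y + y)) ≡ [ 0ℤ ]
        ν-z = ν-1+ _ (subst ([ 0ℤ ] <⁺_) (≡.sym (ν-neg (y + y)))
          (0<ν-double y (<∞⇒≤∞ (1≤∞⇒0<∞ 1≤y))))

    from-inverse : (∃ λ b → (a * four) * b ≈ 1#) → ∃ λ z → ν z ≡ [ 0ℤ ] × a + w ≈ a * (z * z)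
    from-inverse (b , 4ab≈1) = from-root (- w * b) 4aγ≈-w (quadratic-root _ (0<νγ _ 4aγ≈-w))
      where
      4aγ≈-w : (a * four) * (- w * b) ≈ - w
      4aγ≈-w = *-inverse-cancel 4ab≈1 (- w)

-- The valuation of a quaternion division algebra

module QuaternionProperties {c ℓ} {k : DyadicLocalField c ℓ} (D : QuaternionDivisionAlgebra k) where

  private
    module k = DyadicLocalField k
    module kₚ = FieldProperties k
    module k-Reasoning = Relation.Binary.Reasoning.Setoid k.setoid
  open QuaternionDivisionAlgebra D hiding (zero) renaming (refl to ≈-refl)
  open QuaternionAlgebra k.commutativeRing α β using (eq)
  open QuaternionAlgebra._≈_ using (re-≈)
  open QuaternionAlgebra.Solver k.commutativeRing α β
    using (Polynomial; solve; _:=_; _:+_; _:*_; _:-_; :-_; _⊛_; _⊕_)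

  -- The reduced trace: q + conj q is the scalar `T q`.
  T : Carrier → k.Carrier
  T q = Quaternion.re q k.+ Quaternion.re q

  private
    conjᵖ : ∀ {n} → Quaternion (Polynomial n) → Quaternion (Polynomial n)
    conjᵖ (quat a b c d) = quat a (:- b) (:- c) (:- d)

    Nᵖ : ∀ {n} → (α̂ β̂ : Polynomial n) → Quaternion (Polynomial n) → Polynomial n
    Nᵖ α̂ β̂ (quat a b c d) = a :* a :- α̂ :* (b :* b) :- β̂ :* (c :* c) :+ α̂ :* β̂ :* (d :* d)

  N-cong : ∀ {p q} → p ≈ q → N p k.≈ N q
  N-cong (eq a b c d) = k.+-cong (k.+-cong (k.+-cong (k.*-cong a a)
    (k.-‿cong (k.*-congˡ (k.*-cong b b)))) (k.-‿cong (k.*-congˡ (k.*-cong c c))))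
    (k.*-congˡ (k.*-cong d d))

  N-* : ∀ p q → N (p * q) k.≈ N p k.* N q
  N-* (quat a b c d) (quat a′ b′ c′ d′) =
    solve 10 (λ α̂ β̂ a b c d a′ b′ c′ d′ →
        Nᵖ α̂ β̂ (_⊛_ α̂ β̂ (quat a b c d) (quat a′ b′ c′ d′)) :=
        Nᵖ α̂ β̂ (quat a b c d) :* Nᵖ α̂ β̂ (quat a′ b′ c′ d′))
      k.refl α β a b c d a′ b′ c′ d′

  N-conj : ∀ q → N (conj q) k.≈ N q
  N-conj (quat a b c d) = solve 6 (λ α̂ β̂ a b c d →
    Nᵖ α̂ β̂ (conjᵖ (quat a b c d)) := Nᵖ α̂ β̂ (quat a b c d)) k.refl α β a b c d

  -- Polarization of the norm form. The cross term is the only one not controlled by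
  -- multiplicativity of `ν`; the trace bound takes care of it.
  N-+ : ∀ p q → N (p + q) k.≈ N p k.+ (N q k.+ T (p * conj q))
  N-+ (quat a b c d) (quat a′ b′ c′ d′) =
    solve 10 (λ α̂ β̂ a b c d a′ b′ c′ d′ →
        let p = quat a b c d; q = quat a′ b′ c′ d′; r = Quaternion.re (_⊛_ α̂ β̂ p (conjᵖ q)) in
        Nᵖ α̂ β̂ (p ⊕ q) := Nᵖ α̂ β̂ p :+ (Nᵖ α̂ β̂ q :+ (r :+ r)))
      k.refl α β a b c d a′ b′ c′ d′

  conj-cong : ∀ {p q} → p ≈ q → conj p ≈ conj q
  conj-cong (eq a b c d) = eq a (k.-‿cong b) (k.-‿cong c) (k.-‿cong d)

  conj-* : ∀ p q → conj (p * q) ≈ conj q * conj p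
  conj-* (quat a b c d) (quat a′ b′ c′ d′) = eq
    (solve 10 (λ α̂ β̂ a b c d a′ b′ c′ d′ →
        Quaternion.re (conjᵖ (_⊛_ α̂ β̂ (quat a b c d) (quat a′ b′ c′ d′))) :=
        Quaternion.re (_⊛_ α̂ β̂ (conjᵖ (quat a′ b′ c′ d′)) (conjᵖ (quat a b c d))))
      k.refl α β a b c d a′ b′ c′ d′)
    (solve 10 (λ α̂ β̂ a b c d a′ b′ c′ d′ →
        Quaternion.im-i (conjᵖ (_⊛_ α̂ β̂ (quat a b c d) (quat a′ b′ c′ d′))) :=
        Quaternion.im-i (_⊛_ α̂ β̂ (conjᵖ (quat a′ b′ c′ d′)) (conjᵖ (quat a b c d))))
      k.refl α β a b c d a′ b′ c′ d′)
    (solve 10 (λ α̂ β̂ a b c d a′ b′ c′ d′ →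
        Quaternion.im-j (conjᵖ (_⊛_ α̂ β̂ (quat a b c d) (quat a′ b′ c′ d′))) :=
        Quaternion.im-j (_⊛_ α̂ β̂ (conjᵖ (quat a′ b′ c′ d′)) (conjᵖ (quat a b c d))))
      k.refl α β a b c d a′ b′ c′ d′)
    (solve 10 (λ α̂ β̂ a b c d a′ b′ c′ d′ →
        Quaternion.im-k (conjᵖ (_⊛_ α̂ β̂ (quat a b c d) (quat a′ b′ c′ d′))) :=
        Quaternion.im-k (_⊛_ α̂ β̂ (conjᵖ (quat a′ b′ c′ d′)) (conjᵖ (quat a b c d))))
      k.refl α β a b c d a′ b′ c′ d′)

  private
    -0≈0 : k.- k.0# k.≈ k.0#
    -0≈0 = Algebra.Properties.AbelianGroup.ε⁻¹≈ε k.+-abelianGroup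

  conj-0 : conj 0# ≈ 0#
  conj-0 = eq k.refl -0≈0 -0≈0 -0≈0

  conj-1 : conj 1# ≈ 1#
  conj-1 = eq k.refl -0≈0 -0≈0 -0≈0

  N-ι : ∀ a → N (ι a) k.≈ a k.* a
  N-ι a = begin
    a k.* a k.- α k.* (k.0# k.* k.0#) k.- β k.* (k.0# k.* k.0#) k.+ α k.* β k.* (k.0# k.* k.0#)
      ≈⟨ k.+-cong (k.+-cong (k.+-congˡ (k.-‿cong (vanish α))) (k.-‿cong (vanish β))) (vanish (α k.* β)) ⟩
    a k.* a k.- k.0# k.- k.0# k.+ k.0#  ≈⟨ k.+-identityʳ _ ⟩
    a k.* a k.- k.0# k.- k.0#           ≈⟨ minus-0 _ ⟩
    a k.* a k.- k.0#                    ≈⟨ minus-0 _ ⟩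
    a k.* a                             ∎
    where
    open k-Reasoning
    vanish : ∀ b → b k.* (k.0# k.* k.0#) k.≈ k.0#
    vanish b = k.trans (k.*-congˡ (k.zeroˡ k.0#)) (k.zeroʳ b)
    minus-0 : ∀ b → b k.- k.0# k.≈ b
    minus-0 b = k.trans (k.+-congˡ -0≈0) (k.+-identityʳ b)

  N-1 : N 1# k.≈ k.1#
  N-1 = k.trans (N-ι k.1#) (k.*-identityˡ k.1#)

  N-0 : N 0# k.≈ k.0#
  N-0 = k.trans (N-ι k.0#) (k.zeroˡ k.0#)

  ν-cong : ∀ {p q} → p ≈ q → ν p ≡ ν q
  ν-cong p≈q = k.ν-cong (N-cong p≈q)

  ν-* : ∀ p q → ν (p * q) ≡ ν p +∞ ν q
  ν-* p q = ≡.trans (k.ν-cong (N-* p q)) (k.ν-* (N p) (N q))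

  ν-conj : ∀ q → ν (conj q) ≡ ν q
  ν-conj q = k.ν-cong (N-conj q)

  ν-0 : ν 0# ≡ ⊤⁺
  ν-0 = ≡.trans (k.ν-cong N-0) k.ν-0

  ν-1 : ν 1# ≡ [ 0ℤ ]
  ν-1 = ≡.trans (k.ν-cong N-1) kₚ.ν-1

  -- The norm squares scalars, so N(2) is the 4 of k, and ν(4) = 2 ν(2) in D.
  ν-4 : ν 4# ≡ k.ν kₚ.four +∞ k.ν kₚ.four
  ν-4 = ≡.trans (ν-* 2# 2#) (cong₂ _+∞_ ν-2 ν-2)
    where
    ν-2 : ν 2# ≡ k.ν kₚ.four
    ν-2 = k.ν-cong (k.trans (N-cong {2#} {ι kₚ.two}
      (eq k.refl (k.+-identityˡ _) (k.+-identityˡ _) (k.+-identityˡ _))) (N-ι kₚ.two))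

  ≈0? : ∀ q → Dec (q ≈ 0#)
  ≈0? (quat a b c d) with kₚ.≈0? a | kₚ.≈0? b | kₚ.≈0? c | kₚ.≈0? d
  ... | yes a≈0 | yes b≈0 | yes c≈0 | yes d≈0 = yes (eq a≈0 b≈0 c≈0 d≈0)
  ... | no a≉0  | _       | _       | _       = no λ { (eq a≈0 _ _ _) → a≉0 a≈0 }
  ... | yes _   | no b≉0  | _       | _       = no λ { (eq _ b≈0 _ _) → b≉0 b≈0 }
  ... | yes _   | yes _   | no c≉0  | _       = no λ { (eq _ _ c≈0 _) → c≉0 c≈0 }
  ... | yes _   | yes _   | yes _   | no d≉0  = no λ { (eq _ _ _ d≈0) → d≉0 d≈0 }

  -- An inverse of `q` has a norm inverse to `N q`. This is how the division property of D reaches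
  -- the norm form.
  N-≉0 : ∀ {q} → q ≉ 0# → N q k.≉ k.0#
  N-≉0 {q} q≉0 Nq≈0 = kₚ.1≉0 (begin
    k.1#          ≈⟨ N-1 ⟨
    N 1#          ≈⟨ N-cong (proj₁ (proj₂ (invertible q q≉0))) ⟨
    N (p * q)     ≈⟨ N-* p q ⟩
    N p k.* N q   ≈⟨ k.*-congˡ Nq≈0 ⟩
    N p k.* k.0#  ≈⟨ k.zeroʳ _ ⟩
    k.0#          ∎)
    where
    open k-Reasoning
    p : Carrier
    p = proj₁ (invertible q q≉0)

  anisotropic : ∀ q → N q k.≈ k.0# → q ≈ 0#
  anisotropic q Nq≈0 with ≈0? q
  ... | yes q≈0 = q≈0
  ... | no  q≉0 = contradiction Nq≈0 (N-≉0 q≉0)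

  ν-finite : ∀ {q} → q ≉ 0# → ∃ λ i → ν q ≡ [ i ]
  ν-finite q≉0 = kₚ.ν-finite (N-≉0 q≉0)

  ν-≉0 : ∀ {q i} → ν q ≡ [ i ] → q ≉ 0#
  ν-≉0 νq≡i q≈0 = contradiction (≡.trans (≡.sym νq≡i) (≡.trans (ν-cong q≈0) ν-0)) λ ()

  -- The trace bound via the reduced characteristic polynomial.

  private
    -- The right side is the reduced characteristic polynomial of `quat a b c d` at `r`, so a root
    -- of it in k is a zero of the norm form.
    N-shift : ∀ a b c d r → N (quat (a k.- r) b c d) k.≈
      N (quat a b c d) k.- (a k.+ a) k.* r k.+ r k.* r
    N-shift a b c d r = solve 7 (λ α̂ β̂ a b c d r → Nᵖ α̂ β̂ (quat (a :- r) b c d) :=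
      Nᵖ α̂ β̂ (quat a b c d) :- (a :+ a) :* r :+ r :* r) k.refl α β a b c d r

    -- With N = t²γ, the substitution X = tY turns X² - tX + N into t²(Y² - Y + γ), the shape solved
    -- by `quadratic-root`.
    factor : ∀ t γ y → (t k.* t) k.* γ k.- t k.* (t k.* y) k.+ (t k.* y) k.* (t k.* y) k.≈
      (t k.* t) k.* ((γ k.+ y k.* y) k.- y)
    factor = solve 3 (λ t γ y → (t :* t) :* γ :- t :* (t :* y) :+ (t :* y) :* (t :* y) :=
      (t :* t) :* ((γ :+ y :* y) :- y)) k.refl

  -- Otherwise X² - T(q) X + N(q) has a root in k by Hensel's lemma, so
  -- that q ∈ k, where the bound is clear.
  ν-trace : ∀ q → ν q ≤⁺ k.ν (T q) +∞ k.ν (T q)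
  ν-trace q@(quat a b c d) with ≤∞⊎>∞ (ν q) (k.ν (T q) +∞ k.ν (T q))
  ... | inj₁ bound = bound
  ... | inj₂ 2νt<νq = ⊥-elim (from-inverse (k.inverse (t k.* t) (kₚ.*-≉0 t≉0 t≉0)))
    where
    t : k.Carrier
    t = T q

    t≉0 : t k.≉ k.0#
    t≉0 t≈0 = ⊤⁺≮∞ (subst (λ u → u +∞ u <⁺ ν q) (≡.trans (k.ν-cong t≈0) k.ν-0) 2νt<νq)

    module _ (γ : k.Carrier) (t²γ≈N : (t k.* t) k.* γ k.≈ N q) where
      0<νγ : [ 0ℤ ] <⁺ k.ν γ
      0<νγ = +∞-cancelʳ-< (k.ν (t k.* t)) (subst₂ _<⁺_
        (≡.trans (≡.sym (k.ν-* t t)) (≡.sym (+∞-identityˡ _)))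
        (≡.trans (k.ν-cong (k.sym t²γ≈N)) (≡.trans (k.ν-* _ γ) (+∞-comm _ (k.ν γ))))
        2νt<νq)

      from-root : ¬ (∃ λ y → [ 1ℤ ] ≤⁺ k.ν y × y k.≈ γ k.+ y k.* y)
      from-root (y , 1≤y , y-eq) = <∞⇒≱∞ νt<νt ≤∞-refl
        where
        N≈0 : N (quat (a k.- t k.* y) b c d) k.≈ k.0#
        N≈0 = begin
          N (quat (a k.- t k.* y) b c d)
            ≈⟨ N-shift a b c d (t k.* y) ⟩
          N q k.- t k.* (t k.* y) k.+ (t k.* y) k.* (t k.* y)
            ≈⟨ k.+-congʳ (k.+-congʳ (k.sym t²γ≈N)) ⟩
          (t k.* t) k.* γ k.- t k.* (t k.* y) k.+ (t k.* y) k.* (t k.* y)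
            ≈⟨ factor t γ y ⟩
          (t k.* t) k.* ((γ k.+ y k.* y) k.- y)
            ≈⟨ k.*-congˡ (x≈y⇒x∙y⁻¹≈ε (k.sym y-eq)) ⟩
          (t k.* t) k.* k.0#
            ≈⟨ k.zeroʳ _ ⟩
          k.0# ∎
          where
          open k-Reasoning
          open Algebra.Properties.AbelianGroup k.+-abelianGroup using (x≈y⇒x∙y⁻¹≈ε)

        a≈ty : a k.≈ t k.* y
        a≈ty = x∙y⁻¹≈ε⇒x≈y a (t k.* y) (re-≈ (anisotropic _ N≈0))
          where open Algebra.Properties.AbelianGroup k.+-abelianGroup using (x∙y⁻¹≈ε⇒x≈y)

        -- The real part alone gives the contradiction: t = 2a = t * 2y with ν(2y) > 0 is impossible
        -- for nonzero `t`.
        t≈t2y : t k.≈ t k.* (y k.+ y)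
        t≈t2y = k.trans (k.+-cong a≈ty a≈ty) (k.sym (k.distribˡ t y y))

        νt<νt : k.ν t <⁺ k.ν t
        νt<νt = subst (k.ν t <⁺_) (k.ν-cong (k.sym t≈t2y))
          (kₚ.ν-*-< t≉0 (kₚ.0<ν-double y (<∞⇒≤∞ (1≤∞⇒0<∞ 1≤y))))

    from-inverse : ¬ (∃ λ b → (t k.* t) k.* b k.≈ k.1#)
    from-inverse (b , t²b≈1) = from-root (N q k.* b) t²γ≈N (kₚ.quadratic-root _ (0<νγ _ t²γ≈N))
      where
      t²γ≈N : (t k.* t) k.* (N q k.* b) k.≈ N q
      t²γ≈N = kₚ.*-inverse-cancel t²b≈1 (N q)

  ν-T-conj : ∀ p q → ν p +∞ ν q ≤⁺ k.ν (T (p * conj q)) +∞ k.ν (T (p * conj q))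
  ν-T-conj p q = subst (_≤⁺ k.ν (T (p * conj q)) +∞ k.ν (T (p * conj q)))
    (≡.trans (ν-* p (conj q)) (cong (ν p +∞_) (ν-conj q))) (ν-trace (p * conj q))

  -- N(p + q) consists of N(p), N(q) and a trace; twice the value of the trace is at least ν(p) +
  -- ν(q), hence at least 2e.
  ν-+-≥ : ∀ {e} p q → e ≤⁺ ν p → e ≤⁺ ν q → e ≤⁺ ν (p + q)
  ν-+-≥ {e} p q e≤νp e≤νq = subst (e ≤⁺_) (≡.sym (k.ν-cong (N-+ p q)))
    (kₚ.ν-+-≥ _ _ e≤νp (kₚ.ν-+-≥ _ _ e≤νq
      (double-cancel-≤ (≤∞-trans (+∞-mono-≤ e≤νp e≤νq) (ν-T-conj p q)))))

  ν-+-> : ∀ {e} p q → e <⁺ ν p → e <⁺ ν q → e <⁺ ν (p + q)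
  ν-+-> p q e<νp e<νq with ≤∞-total (ν p) (ν q)
  ... | inj₁ νp≤νq = <-≤∞-trans e<νp (ν-+-≥ p q ≤∞-refl νp≤νq)
  ... | inj₂ νq≤νp = <-≤∞-trans e<νq (ν-+-≥ p q νq≤νp ≤∞-refl)

  open Algebra.Properties.Semiring.Sum semiring public using (sum)

  ν-sum-≥ : ∀ {e n} (f : Fin n → Carrier) → (∀ i → e ≤⁺ ν (f i)) → e ≤⁺ ν (sum f)
  ν-sum-≥ {e} {zero}  f e≤ = subst (e ≤⁺_) (≡.sym ν-0) (_ ≤⊤⁺)
  ν-sum-≥ {e} {suc n} f e≤ = ν-+-≥ _ _ (e≤ zero) (ν-sum-≥ _ (λ i → e≤ (suc i)))

  -- The threshold is finite because the empty sum has value ∞, which is not strictly above ∞.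
  ν-sum-> : ∀ {i n} (f : Fin n → Carrier) → (∀ l → [ i ] <⁺ ν (f l)) → [ i ] <⁺ ν (sum f)
  ν-sum-> {i} {zero}  f i< = subst ([ i ] <⁺_) (≡.sym ν-0) [ i ]<⊤⁺
  ν-sum-> {i} {suc n} f i< = ν-+-> _ _ (i< zero) (ν-sum-> _ (λ l → i< (suc l)))

  𝓞-0 : 𝓞 0#
  𝓞-0 = subst (ν 1# ≤⁺_) (≡.sym ν-0) (_ ≤⊤⁺)

  𝓞-* : ∀ p q → 𝓞 p → 𝓞 q → 𝓞 (p * q)
  𝓞-* p q p∈𝓞 q∈𝓞 = subst₂ _≤⁺_ (≡.trans (cong (_+∞ ν 1#) ν-1) (+∞-identityˡ _)) (≡.sym (ν-* p q))
    (+∞-mono-≤ p∈𝓞 q∈𝓞)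

  𝓞-cong : ∀ {p q} → p ≈ q → 𝓞 p → 𝓞 q
  𝓞-cong p≈q = subst (ν 1# ≤⁺_) (ν-cong p≈q)

  -- N(a + c) = N(a) + N(c) + T(a c̄), where the last two terms are
  -- divisible by 4 N(a) 𝔭.
  N-perturbation : ∀ a c → a ≉ 0# → ν a +∞ ν 4# <⁺ ν c →
    ∃ λ z → k.ν z ≡ [ 0ℤ ] × N (a + c) k.≈ N a k.* (z k.* z)
  N-perturbation a c a≉0 νa+ν4<νc = from-value (ν-finite a≉0)
    where
    t : k.Carrier
    t = T (a * conj c)
    f : ℤ∞
    f = k.ν kₚ.four

    module _ (i : ℤ) (νa≡i : ν a ≡ [ i ]) where
      bound : [ i ] +∞ (f +∞ f) <⁺ ν c
      bound = subst₂ (λ u v → u +∞ v <⁺ ν c) νa≡i ν-4 νa+ν4<νc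

      -- One of the two copies of `f` in ν(4) is given away, as f ≥ 0.
      bound-N : ν a +∞ f <⁺ ν c
      bound-N = subst (λ u → u +∞ f <⁺ ν c) (≡.sym νa≡i) (≤-<∞-trans
        (+∞-mono-≤ {[ i ]} ≤∞-refl (subst (_≤⁺ f +∞ f) (+∞-identityˡ f) (+∞-mono-≤ kₚ.0≤ν-four ≤∞-refl)))
        bound)

      -- Proved after doubling: 2(ν(a) + f) = ν(a) + (ν(a) + 2f) < ν(a) + ν(c) ≤ 2ν(t).
      bound-t : ν a +∞ f <⁺ k.ν t
      bound-t = subst (λ u → u +∞ f <⁺ k.ν t) (≡.sym νa≡i) (double-cancel-<
        (<-≤∞-trans (subst (_<⁺ [ i ] +∞ ν c) (≡.sym (+∞-interchange [ i ] f)) (+∞-monoʳ-< i bound))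
          (subst (λ u → u +∞ ν c ≤⁺ k.ν t +∞ k.ν t) νa≡i (ν-T-conj a c))))

    from-square : (∃ λ z → k.ν z ≡ [ 0ℤ ] × N a k.+ (N c k.+ t) k.≈ N a k.* (z k.* z)) →
      ∃ λ z → k.ν z ≡ [ 0ℤ ] × N (a + c) k.≈ N a k.* (z k.* z)
    from-square (z , νz≡0 , e) = z , νz≡0 , k.trans (N-+ a c) e

    from-value : (∃ λ i → ν a ≡ [ i ]) → ∃ λ z → k.ν z ≡ [ 0ℤ ] × N (a + c) k.≈ N a k.* (z k.* z)
    from-value (i , νa≡i) = from-square (kₚ.square-perturbation (N a) (N c k.+ t) (N-≉0 a≉0)
      (kₚ.ν-+-> (N c) t (bound-N i νa≡i) (bound-t i νa≡i)))

  -- For p = 0 the premise forces ν(q) = ∞, so q = 0 and the quotient 0 serves; otherwise `p⁻¹ * q`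
  -- is integral by multiplicativity.
  divide : ∀ p q → ∣ q ∣≤∣ p ∣ → ∃ λ r → 𝓞 r × p * r ≈ q
  divide p q νp≤νq with ≈0? p
  ... | yes p≈0 = 0# , 𝓞-0 , trans (zeroʳ p) (sym q≈0)
    where
    q≈0 : q ≈ 0#
    q≈0 = anisotropic q (k.ν-∞ _ (≤∞-antisym (_ ≤⊤⁺) (subst (_≤⁺ ν q) (≡.trans (ν-cong p≈0) ν-0) νp≤νq)))
  ... | no p≉0 with invertible p p≉0
  ...   | p⁻¹ , p⁻¹p≈1 , pp⁻¹≈1 = p⁻¹ * q ,
    subst₂ _≤⁺_ (≡.trans (≡.sym (ν-* p⁻¹ p)) (ν-cong p⁻¹p≈1)) (≡.sym (ν-* p⁻¹ q)) (+∞-mono-≤ ≤∞-refl νp≤νq) ,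
    trans (sym (*-assoc p p⁻¹ q)) (trans (*-congʳ pp⁻¹≈1) (*-identityˡ q))

  *-cancelʳ : ∀ {a} → a ≉ 0# → ∀ {p q} → p * a ≈ q * a → p ≈ q
  *-cancelʳ {a} a≉0 {p} {q} pa≈qa with invertible a a≉0
  ... | b , _ , ab≈1 = trans (sym (undo p)) (trans (*-congʳ pa≈qa) (undo q))
    where
    undo : ∀ p → (p * a) * b ≈ p
    undo p = trans (*-assoc p a b) (trans (*-congˡ ab≈1) (*-identityʳ p))

  k*²-trans : ∀ {x y z} → x ∈ y k*² → y ∈ z k*² → x ∈ z k*²
  k*²-trans {z = z} (p , p≉0 , x≈) (q , q≉0 , y≈) = q k.* p , kₚ.*-≉0 q≉0 p≉0 ,
    k.trans x≈ (k.trans (k.*-congʳ y≈) (k.trans (k.*-assoc z _ _) (k.*-congˡ (interchange q q p p))))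
    where open Algebra.Properties.CommutativeSemigroup k.*-commutativeSemigroup using (interchange)

-- Finite families

⊓∞-foldr-≤ : ∀ {n} (f : Fin n → ℤ∞) i → foldr _⊓∞_ ⊤⁺ f ≤⁺ f i
⊓∞-foldr-≤ f zero    = ⊓∞-≤ˡ (f zero) _
⊓∞-foldr-≤ f (suc i) = ≤∞-trans (⊓∞-≤ʳ (f zero) _) (⊓∞-foldr-≤ (f ∘ suc) i)

⊓∞-foldr-glb : ∀ {n e} (f : Fin n → ℤ∞) → (∀ i → e ≤⁺ f i) → e ≤⁺ foldr _⊓∞_ ⊤⁺ f
⊓∞-foldr-glb {zero}  f e≤ = _ ≤⊤⁺
⊓∞-foldr-glb {suc n} f e≤ = ⊓∞-glb (e≤ zero) (⊓∞-foldr-glb (f ∘ suc) (e≤ ∘ suc))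

ascending⇒monotone : ∀ {n} (f : Fin (suc n) → ℤ∞) → (∀ i → f (inject₁ i) ≤⁺ f (suc i)) →
  ∀ j l → j ≤ᶠ l → f j ≤⁺ f l
ascending⇒monotone         f asc zero    zero    _         = ≤∞-refl
ascending⇒monotone {suc n} f asc zero    (suc l) _         =
  ≤∞-trans (asc zero) (ascending⇒monotone (f ∘ suc) (asc ∘ suc) zero l ℕ.z≤n)
ascending⇒monotone {suc n} f asc (suc j) (suc l) (ℕ.s≤s p) =
  ascending⇒monotone (f ∘ suc) (asc ∘ suc) j l p

-- `Ascending` and `μ` are phrased through the pairs `inject₁ i`, `suc i`; adjacent indices are
-- brought to that form here.
consecutive : ∀ {n} (j l : Fin (suc n)) → toℕ l ≡ suc (toℕ j) → ∃ λ i → inject₁ i ≡ j × suc i ≡ l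
consecutive j (suc i) eq = i , Finₚ.toℕ-injective (≡.trans (Finₚ.toℕ-inject₁ i) (ℕₚ.suc-injective eq)) , refl

module SumProperties {c ℓ} (M : CommutativeMonoid c ℓ) where

  open CommutativeMonoid M
  open Algebra.Properties.CommutativeMonoid.Sum M

  sum-zero : ∀ {n} (f : Fin n → Carrier) → (∀ i → f i ≈ ε) → sum f ≈ ε
  sum-zero {n} f f≈ε = trans (sum-cong-≋ f≈ε) (sum-replicate-zero n)

  sum-single : ∀ {n} (f : Fin n → Carrier) i → (∀ j → j ≢ i → f j ≈ ε) → sum f ≈ f i
  sum-single {suc n} f i f≈ε = trans (sum-remove f)
    (trans (∙-congˡ (sum-zero (removeAt f i) (λ j → f≈ε (punchIn i j) (Finₚ.punchInᵢ≢i i j)))) (identityʳ (f i)))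

-- Diagonal lattices in a skew-hermitian space

module LatticeProperties {c ℓ v ℓv} {k : DyadicLocalField c ℓ} {D : QuaternionDivisionAlgebra k}
                         (V : SkewHermitianSpace D v ℓv) where

  private
    module k = DyadicLocalField k
  open QuaternionDivisionAlgebra D hiding (zero) renaming (refl to ≈-refl; _+_ to infixl 6 _+ᴰ_)
  open QuaternionProperties D
  open SkewHermitianSpace V
  open Algebra.Properties.Ring ring using (-‿distribˡ-*)
  open Algebra.Module.Properties.LeftModule leftModule using (inverseʳ-uniqueᴹ)
  private
    module Σᴰ = Algebra.Properties.Semiring.Sum semiring
    module Σᴹ = Algebra.Properties.CommutativeMonoid.Sum +ᴹ-commutativeMonoid
    module Sᴰ = SumProperties +-commutativeMonoid
    module ᴰ-Reasoning = Relation.Binary.Reasoning.Setoid setoid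
    module ᴹ-Reasoning = Relation.Binary.Reasoning.Setoid ≈ᴹ-setoid

  -ᴹ-*ₗ : ∀ q x → -ᴹ (q *ₗ x) ≈ᴹ (- q) *ₗ x
  -ᴹ-*ₗ q x = ≈ᴹ-sym (inverseʳ-uniqueᴹ (q *ₗ x) ((- q) *ₗ x)
    (≈ᴹ-trans (≈ᴹ-sym (*ₗ-distribʳ x q (- q))) (≈ᴹ-trans (*ₗ-congʳ (-‿inverseʳ q)) (*ₗ-zeroˡ x))))

  lincomb-cong : ∀ {n} {p q : Fin n → Carrier} (x : Fin n → Carrierᴹ) →
    (∀ i → p i ≈ q i) → lincomb p x ≈ᴹ lincomb q x
  lincomb-cong x p≈q = Σᴹ.sum-cong-≋ (λ i → *ₗ-congʳ (p≈q i))

  lincomb-+ : ∀ {n} (p q : Fin n → Carrier) (x : Fin n → Carrierᴹ) →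
    lincomb p x +ᴹ lincomb q x ≈ᴹ lincomb (λ i → p i +ᴰ q i) x
  lincomb-+ p q x = ≈ᴹ-trans (≈ᴹ-sym (Σᴹ.∑-distrib-+ (λ i → p i *ₗ x i) (λ i → q i *ₗ x i)))
    (Σᴹ.sum-cong-≋ (λ i → ≈ᴹ-sym (*ₗ-distribʳ (x i) (p i) (q i))))

  *ₗ-∑ : ∀ {n} q (x : Fin n → Carrierᴹ) → q *ₗ ∑ x ≈ᴹ ∑ (λ i → q *ₗ x i)
  *ₗ-∑ {zero}  q x = *ₗ-zeroʳ q
  *ₗ-∑ {suc n} q x = ≈ᴹ-trans (*ₗ-distribˡ q (x zero) _) (+ᴹ-congˡ (*ₗ-∑ q (x ∘ suc)))

  sum-*ₗ : ∀ {n} (q : Fin n → Carrier) x → sum q *ₗ x ≈ᴹ ∑ (λ i → q i *ₗ x)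
  sum-*ₗ {zero}  q x = *ₗ-zeroˡ x
  sum-*ₗ {suc n} q x = ≈ᴹ-trans (*ₗ-distribʳ x (q zero) _) (+ᴹ-congˡ (sum-*ₗ (q ∘ suc) x))

  *ₗ-lincomb : ∀ {n} c (q : Fin n → Carrier) (x : Fin n → Carrierᴹ) →
    c *ₗ lincomb q x ≈ᴹ lincomb (λ i → c * q i) x
  *ₗ-lincomb c q x = ≈ᴹ-trans (*ₗ-∑ c (λ i → q i *ₗ x i))
    (Σᴹ.sum-cong-≋ (λ i → ≈ᴹ-sym (*ₗ-assoc c (q i) (x i))))

  lincomb-lincomb : ∀ {m n} (q : Fin m → Carrier) (M : Fin m → Fin n → Carrier) (x : Fin n → Carrierᴹ) →
    lincomb q (λ i → lincomb (M i) x) ≈ᴹ lincomb (λ l → sum (λ i → q i * M i l)) x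
  lincomb-lincomb q M x = begin
    ∑ (λ i → q i *ₗ ∑ (λ l → M i l *ₗ x l))    ≈⟨ Σᴹ.sum-cong-≋ (λ i → *ₗ-lincomb (q i) (M i) x) ⟩
    ∑ (λ i → ∑ (λ l → (q i * M i l) *ₗ x l))   ≈⟨ Σᴹ.∑-comm (λ i l → (q i * M i l) *ₗ x l) ⟩
    ∑ (λ l → ∑ (λ i → (q i * M i l) *ₗ x l))   ≈⟨ Σᴹ.sum-cong-≋ (λ l → ≈ᴹ-sym (sum-*ₗ (λ i → q i * M i l) (x l))) ⟩
    ∑ (λ l → sum (λ i → q i * M i l) *ₗ x l)   ∎
    where open ᴹ-Reasoning

  h-zeroˡ : ∀ y → h 0ᴹ y ≈ 0#
  h-zeroˡ y = trans (h-cong (≈ᴹ-sym (*ₗ-zeroˡ 0ᴹ)) ≈ᴹ-refl) (trans (h-* 0# 0ᴹ y) (zeroˡ _))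

  h-lincomb : ∀ {n} (q : Fin n → Carrier) (x : Fin n → Carrierᴹ) y →
    h (lincomb q x) y ≈ sum (λ i → q i * h (x i) y)
  h-lincomb {zero}  q x y = h-zeroˡ y
  h-lincomb {suc n} q x y = trans (h-+ _ _ y) (+-cong (h-* (q zero) (x zero) y) (h-lincomb (q ∘ suc) (x ∘ suc) y))

  h-self-pure : ∀ x → Pure (h x x)
  h-self-pure x = trans (sym (⁻¹-involutive _)) (-‿cong (sym (h-skew x x)))
    where open Algebra.Properties.AbelianGroup +-abelianGroup using (⁻¹-involutive)

  module _ {n} (Λ : DiagonalLattice V n) where
    open DiagonalLattice Λ

    h-coordinate : ∀ (q : Fin n → Carrier) l → h (lincomb q s) (s l) ≈ q l * a l
    h-coordinate q l = begin
      h (lincomb q s) (s l)              ≈⟨ h-lincomb q s (s l) ⟩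
      sum (λ i → q i * h (s i) (s l))    ≈⟨ Sᴰ.sum-single _ l (λ i i≢l → trans (*-congˡ (orthogonal i l i≢l)) (zeroʳ _)) ⟩
      q l * h (s l) (s l)                ≈⟨ *-congˡ (h-diagonal l) ⟩
      q l * a l                          ∎
      where open ᴰ-Reasoning

    -- Pairing with `s l` isolates `p l * a l` by orthogonality, and `a l` is invertible.
    coordinates-unique : ∀ (p q : Fin n → Carrier) → lincomb p s ≈ᴹ lincomb q s → ∀ l → p l ≈ q l
    coordinates-unique p q p≈q l = *-cancelʳ (a≉0 l)
      (trans (sym (h-coordinate p l)) (trans (h-cong p≈q ≈ᴹ-refl) (h-coordinate q l)))

    ∈D-+-* : ∀ {x y} q → x ∈D Λ → y ∈D Λ → x +ᴹ q *ₗ y ∈D Λ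
    ∈D-+-* q (p , x≈) (p′ , y≈) = (λ i → p i +ᴰ q * p′ i) ,
      ≈ᴹ-trans (+ᴹ-cong x≈ (≈ᴹ-trans (*ₗ-congˡ y≈) (*ₗ-lincomb q p′ s))) (lincomb-+ p (λ i → q * p′ i) s)

  ∈⇒∈D : ∀ {n x} (Λ : DiagonalLattice V n) → x ∈ Λ → x ∈D Λ
  ∈⇒∈D Λ (q , _ , x≈) = q , x≈

  -- A rotation along s ∈ DΛ′ moves each vector by a multiple of s, so it
  -- preserves DΛ′ and hence DΛ′ ∩ Λ.
  𝓤⁺-restrict : ∀ {m n} (Λ′ : DiagonalLattice V m) (Λ : DiagonalLattice V n) (ρ : SimpleRotation V) →
    Λ′ ⊆ Λ → (∀ x → x ∈D Λ′ → x ∈D Λ) → (∀ x → x ∈D Λ′ → x ∈ Λ → x ∈ Λ′) →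
    SimpleRotation.s ρ ∈D Λ′ → ρ ∈𝓤⁺ Λ → ρ ∈𝓤⁺ Λ′
  𝓤⁺-restrict Λ′ Λ ρ Λ′⊆Λ D⊆ saturated s∈ (_ , u) = s∈ , record
    { stable    = stable′
    ; φ-cong    = λ x y x∈ y∈ → φ-cong x y (D⊆ x x∈) (D⊆ y y∈)
    ; φ-+       = λ x y x∈ y∈ → φ-+ x y (D⊆ x x∈) (D⊆ y y∈)
    ; φ-*       = λ q x x∈ → φ-* q x (D⊆ x x∈)
    ; isometric = λ x y x∈ y∈ → isometric x y (D⊆ x x∈) (D⊆ y y∈)
    ; φΛ⊆Λ      = λ x x∈ → saturated (apply x) (stable′ x (∈⇒∈D Λ′ x∈)) (φΛ⊆Λ x (Λ′⊆Λ x x∈))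
    ; Λ⊆φΛ      = λ y y∈ → preimage y y∈ (Λ⊆φΛ y (Λ′⊆Λ y y∈))
    }
    where
    open 𝓤⁺ u
    open SimpleRotation ρ

    multiplier : Carrierᴹ → Carrier
    multiplier x = h x s * σ ⁻¹⟨ σ≉0 ⟩

    respects : ∀ {x y} → x ≈ᴹ y → y ∈D Λ′ → x ∈D Λ′
    respects x≈y (q , y≈) = q , ≈ᴹ-trans x≈y y≈

    stable′ : ∀ x → x ∈D Λ′ → apply x ∈D Λ′
    stable′ x x∈ = respects (+ᴹ-congˡ (-ᴹ-*ₗ (multiplier x) s)) (∈D-+-* Λ′ (- multiplier x) x∈ s∈)

    undo : ∀ x → apply x +ᴹ multiplier x *ₗ s ≈ᴹ x
    undo x = ≈ᴹ-trans (+ᴹ-assoc x _ _) (≈ᴹ-trans (+ᴹ-congˡ (-ᴹ‿inverseˡ _)) (+ᴹ-identityʳ x))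

    -- The preimage found in Λ differs from `y` by a multiple of `s`, so it lies in DΛ′ as well.
    preimage : ∀ y → y ∈ Λ′ → (∃ λ x → (x ∈ Λ) × (apply x ≈ᴹ y)) → ∃ λ x → (x ∈ Λ′) × (apply x ≈ᴹ y)
    preimage y y∈ (x , x∈Λ , φx≈y) = x , saturated x x∈D x∈Λ , φx≈y
      where
      x∈D : x ∈D Λ′
      x∈D = respects (≈ᴹ-sym (undo x)) (∈D-+-* Λ′ (multiplier x) (respects φx≈y (∈⇒∈D Λ′ y∈)) s∈)

  -- w τ = s τ + ∑_{l > τ} κ l s l, and w j = s j for j ≠ τ.  M is the
  -- transition matrix.
  module Refinement {n} (Λ : DiagonalLattice V (suc n)) (τ : Fin (suc n))
                    (κ : Fin (suc n) → Carrier) (κ∈𝓞 : ∀ l → 𝓞 (κ l)) where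
    open DiagonalLattice Λ

    -- The three cases exclude one another, so an entry of `M` does not depend on the `Position`
    -- that yields it. Lemmas on entries therefore match on an arbitrary `Position`, away from the
    -- decision procedure.
    data Position (j l : Fin (suc n)) : Set where
      diagonal : j ≡ l → Position j l
      tail     : j ≡ τ → τ <ᶠ l → Position j l
      off      : j ≢ l → ¬ (j ≡ τ × τ <ᶠ l) → Position j l

    position : ∀ j l → Position j l
    position j l with j Finₚ.≟ l
    ... | yes j≡l = diagonal j≡l
    ... | no  j≢l with j Finₚ.≟ τ | τ Finₚ.<? l
    ...   | yes j≡τ | yes τ<l = tail j≡τ τ<l
    ...   | no  j≢τ | _       = off j≢l (j≢τ ∘ proj₁)
    ...   | yes _   | no  τ≮l = off j≢l (τ≮l ∘ proj₂)

    coefficient : ∀ {j l} → Position j l → Carrier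
    coefficient         (diagonal _) = 1#
    coefficient {l = l} (tail _ _)   = κ l
    coefficient         (off _ _)    = 0#

    M : Fin (suc n) → Fin (suc n) → Carrier
    M j l = coefficient (position j l)

    coefficient∈𝓞 : ∀ {j l} (p : Position j l) → 𝓞 (coefficient p)
    coefficient∈𝓞         (diagonal _) = ≤∞-refl
    coefficient∈𝓞 {l = l} (tail _ _)   = κ∈𝓞 l
    coefficient∈𝓞         (off _ _)    = 𝓞-0

    coefficient-diagonal : ∀ {j} (p : Position j j) → coefficient p ≈ 1#
    coefficient-diagonal (diagonal _)   = ≈-refl
    coefficient-diagonal (tail j≡τ τ<j) = contradiction (≡.sym j≡τ) (Finₚ.<⇒≢ τ<j)
    coefficient-diagonal (off j≢j _)    = contradiction refl j≢j

    coefficient-tail : ∀ {l} → τ <ᶠ l → (p : Position τ l) → coefficient p ≈ κ l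
    coefficient-tail τ<l (diagonal τ≡l) = contradiction τ≡l (Finₚ.<⇒≢ τ<l)
    coefficient-tail τ<l (tail _ _)     = ≈-refl
    coefficient-tail τ<l (off _ ¬tail)  = contradiction (refl , τ<l) ¬tail

    coefficient-off : ∀ {j l} → j ≢ l → ¬ (j ≡ τ × τ <ᶠ l) → (p : Position j l) → coefficient p ≈ 0#
    coefficient-off j≢l ¬tail (diagonal j≡l)   = contradiction j≡l j≢l
    coefficient-off j≢l ¬tail (tail j≡τ τ<l)   = contradiction (j≡τ , τ<l) ¬tail
    coefficient-off j≢l ¬tail (off _ _)        = ≈-refl

    w : Fin (suc n) → Carrierᴹ
    w j = lincomb (M j) s

    -- Skewness of `h` and purity of `a l` contribute one sign each, and these cancel.
    h-s-w : ∀ l j → h (s l) (w j) ≈ a l * conj (M j l)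
    h-s-w l j = begin
      h (s l) (w j)                   ≈⟨ h-skew (s l) (w j) ⟩
      - conj (h (w j) (s l))          ≈⟨ -‿cong (conj-cong (h-coordinate Λ (M j) l)) ⟩
      - conj (M j l * a l)            ≈⟨ -‿cong (conj-* (M j l) (a l)) ⟩
      - (conj (a l) * conj (M j l))   ≈⟨ -‿cong (*-congʳ (a-pure l)) ⟩
      - (- a l * conj (M j l))        ≈⟨ -‿distribˡ-* (- a l) _ ⟩
      - (- a l) * conj (M j l)        ≈⟨ *-congʳ (⁻¹-involutive (a l)) ⟩
      a l * conj (M j l)              ∎
      where
      open ᴰ-Reasoning
      open Algebra.Properties.AbelianGroup +-abelianGroup using (⁻¹-involutive)

    term : ∀ j j′ → Fin (suc n) → Carrier
    term j j′ l = M j l * (a l * conj (M j′ l))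

    h-w-w : ∀ j j′ → h (w j) (w j′) ≈ sum (term j j′)
    h-w-w j j′ = trans (h-lincomb (M j) s (w j′))
      (Σᴰ.sum-cong-≋ {x = λ l → M j l * h (s l) (w j′)} {term j j′} (λ l → *-congˡ {M j l} (h-s-w l j′)))

    -- Distinct rows of `M` up to `τ` have disjoint supports. A row beyond `τ` could meet the tail
    -- of `w τ`, hence the two bounds.
    w-orthogonal : ∀ {j j′} → j ≤ᶠ τ → j′ ≤ᶠ τ → j ≢ j′ → h (w j) (w j′) ≈ 0#
    w-orthogonal {j} {j′} j≤τ j′≤τ j≢j′ = trans (h-w-w j j′)
      (Sᴰ.sum-zero _ (λ l → vanish (position j l) (position j′ l)))
      where
      vanish : ∀ {l} (p : Position j l) (p′ : Position j′ l) →
        coefficient p * (a l * conj (coefficient p′)) ≈ 0#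
      vanish (off _ _)        p′                 = zeroˡ _
      vanish (diagonal _)     (off _ _)          = trans (*-identityˡ _) (trans (*-congˡ conj-0) (zeroʳ _))
      vanish (tail _ _)       (off _ _)          = trans (*-congˡ (trans (*-congˡ conj-0) (zeroʳ _))) (zeroʳ _)
      vanish (diagonal j≡l)   (diagonal j′≡l)    = contradiction (≡.trans j≡l (≡.sym j′≡l)) j≢j′
      vanish (diagonal refl)  (tail _ τ<l)       = contradiction j≤τ (ℕₚ.<⇒≱ τ<l)
      vanish (tail _ τ<l)     (diagonal refl)    = contradiction j′≤τ (ℕₚ.<⇒≱ τ<l)
      vanish (tail j≡τ _)     (tail j′≡τ _)      = contradiction (≡.trans j≡τ (≡.sym j′≡τ)) j≢j′

    b : Fin (suc n) → Carrier
    b j = h (w j) (w j)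

    coordinates : ∀ {m} (e : Fin m → Fin (suc n)) (q : Fin m → Carrier) → Fin (suc n) → Carrier
    coordinates e q l = sum (λ i → q i * M (e i) l)

    combination : ∀ {m} (e : Fin m → Fin (suc n)) (q : Fin m → Carrier) →
      lincomb q (w ∘ e) ≈ᴹ lincomb (coordinates e q) s
    combination e q = lincomb-lincomb q (M ∘ e) s

    module _ (gap : ∀ {j l} → j <ᶠ l → ν (a j) +∞ ν 4# <⁺ ν (a l))
             (4≉0 : 4# ≉ 0#) where

      private
        threshold : ∀ j → ∃ λ i → ν (a j) +∞ ν 4# ≡ [ i ]
        threshold j = proj₁ (ν-finite (a≉0 j)) ℤ.+ proj₁ (ν-finite 4≉0) ,
          cong₂ _+∞_ (proj₂ (ν-finite (a≉0 j))) (proj₂ (ν-finite 4≉0))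

      -- An off-diagonal term is 0 or, in row `τ`, κ a κ̄ with κ integral, of value at least ν(a l);
      -- the gap then applies.
      ν-term : ∀ {j l i} → j ≢ l → ν (a j) +∞ ν 4# ≡ [ i ] → (p : Position j l) →
        [ i ] <⁺ ν (coefficient p * (a l * conj (coefficient p)))
      ν-term             j≢l _  (diagonal j≡l)   = contradiction j≡l j≢l
      ν-term {l = l} {i} j≢l _  (off _ _)        = subst ([ i ] <⁺_) (≡.sym (≡.trans (ν-cong (zeroˡ _)) ν-0)) [ i ]<⊤⁺
      ν-term {l = l} {i} j≢l th (tail refl τ<l)  = subst (_<⁺ ν (κ l * (a l * conj (κ l)))) th
        (<-≤∞-trans (gap τ<l) νa≤)
        where
        0≤νκ : [ 0ℤ ] ≤⁺ ν (κ l)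
        0≤νκ = subst (_≤⁺ ν (κ l)) ν-1 (κ∈𝓞 l)
        νa≤ : ν (a l) ≤⁺ ν (κ l * (a l * conj (κ l)))
        νa≤ = subst₂ _≤⁺_ (≡.trans (+∞-identityˡ _) (+∞-identityʳ _))
          (≡.sym (≡.trans (ν-* _ _) (cong (ν (κ l) +∞_) (≡.trans (ν-* _ _) (cong (ν (a l) +∞_) (ν-conj (κ l)))))))
          (+∞-mono-≤ 0≤νκ (+∞-mono-≤ (≤∞-refl {ν (a l)}) 0≤νκ))

      -- All rows are treated alike: for j ≠ τ every summand of `rest` vanishes.
      N-b : ∀ j → ∃ λ z → k.ν z ≡ [ 0ℤ ] × N (b j) k.≈ N (a j) k.* (z k.* z)
      N-b j = from-perturbation (N-perturbation (a j) rest (a≉0 j) bound)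
        where
        rest : Carrier
        rest = sum (removeAt (term j j) j)

        M-jj : M j j ≈ 1#
        M-jj = coefficient-diagonal (position j j)

        b≈ : b j ≈ a j +ᴰ rest
        b≈ = begin
          b j                       ≈⟨ h-w-w j j ⟩
          sum (term j j)            ≈⟨ Σᴰ.sum-remove {i = j} (term j j) ⟩
          term j j j +ᴰ rest        ≈⟨ +-congʳ (*-cong M-jj (*-congˡ (trans (conj-cong M-jj) conj-1))) ⟩
          1# * (a j * 1#) +ᴰ rest   ≈⟨ +-congʳ (trans (*-identityˡ _) (*-identityʳ _)) ⟩
          a j +ᴰ rest               ∎
          where open ᴰ-Reasoning

        bound : ν (a j) +∞ ν 4# <⁺ ν rest
        bound = subst (_<⁺ ν rest) (≡.sym (proj₂ (threshold j)))
          (ν-sum-> (removeAt (term j j) j) (λ l →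
            ν-term (Finₚ.punchInᵢ≢i j l ∘ ≡.sym) (proj₂ (threshold j)) (position j (punchIn j l))))

        from-perturbation : (∃ λ z → k.ν z ≡ [ 0ℤ ] × N (a j +ᴰ rest) k.≈ N (a j) k.* (z k.* z)) →
          ∃ λ z → k.ν z ≡ [ 0ℤ ] × N (b j) k.≈ N (a j) k.* (z k.* z)
        from-perturbation (z , νz≡0 , e) = z , νz≡0 , k.trans (N-cong b≈) e

      ν-b : ∀ j → ν (b j) ≡ ν (a j)
      ν-b j = from-square (N-b j)
        where
        from-square : (∃ λ z → k.ν z ≡ [ 0ℤ ] × N (b j) k.≈ N (a j) k.* (z k.* z)) → ν (b j) ≡ ν (a j)
        from-square (z , νz≡0 , e) = ≡.trans (k.ν-cong e) (≡.trans (k.ν-* _ _)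
          (≡.trans (cong (ν (a j) +∞_) (≡.trans (k.ν-* z z) (cong₂ _+∞_ νz≡0 νz≡0))) (+∞-identityʳ _)))

      b≉0 : ∀ j → b j ≉ 0#
      b≉0 j = ν-≉0 (≡.trans (ν-b j) (proj₂ (ν-finite (a≉0 j))))

      module Sublattice {m} (e : Fin m → Fin (suc n)) (e-injective : ∀ {i j} → e i ≡ e j → i ≡ j)
                        (e≤τ : ∀ i → e i ≤ᶠ τ) where

        Λ′ : DiagonalLattice V m
        Λ′ = record
          { a          = b ∘ e
          ; a-pure     = λ i → h-self-pure (w (e i))
          ; a≉0        = λ i → b≉0 (e i)
          ; s          = w ∘ e
          ; h-diagonal = λ i → ≈-refl
          ; orthogonal = λ i j i≢j → w-orthogonal (e≤τ i) (e≤τ j) (i≢j ∘ e-injective)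
          }

        Λ′⊆Λ : Λ′ ⊆ Λ
        Λ′⊆Λ x (q , q∈𝓞 , x≈) = coordinates e q ,
          (λ l → ν-sum-≥ _ (λ i → 𝓞-* _ _ (q∈𝓞 i) (coefficient∈𝓞 (position (e i) l)))) ,
          ≈ᴹ-trans x≈ (combination e q)

        DΛ′⊆DΛ : ∀ x → x ∈D Λ′ → x ∈D Λ
        DΛ′⊆DΛ x (q , x≈) = coordinates e q , ≈ᴹ-trans x≈ (combination e q)

        -- The columns of `M` up to `τ` are those of the identity matrix, so a coefficient on
        -- `w (e i)` reappears unchanged at `s (e i)`. Saturation follows by comparing coordinates
        -- there.
        coordinate : ∀ (q : Fin m → Carrier) i → coordinates e q (e i) ≈ q i
        coordinate q i = trans
          (Sᴰ.sum-single _ i (λ j j≢i → trans (*-congˡ (coefficient-off (j≢i ∘ e-injective)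
            (λ { (_ , τ<ei) → ℕₚ.<⇒≱ τ<ei (e≤τ i) }) (position (e j) (e i)))) (zeroʳ (q j))))
          (trans (*-congˡ (coefficient-diagonal (position (e i) (e i)))) (*-identityʳ (q i)))

        saturated : ∀ x → x ∈D Λ′ → x ∈ Λ → x ∈ Λ′
        saturated x (q , x≈q) (p , p∈𝓞 , x≈p) = q , (λ i → 𝓞-cong (p≈q i) (p∈𝓞 (e i))) , x≈q
          where
          p≈q : ∀ i → p (e i) ≈ q i
          p≈q i = trans (coordinates-unique Λ p (coordinates e q) (≈ᴹ-trans (≈ᴹ-sym x≈p) (≈ᴹ-trans x≈q (combination e q))) (e i))
            (coordinate q i)

        -- The coefficients have to be the coordinates at the places `e i`. Beyond `τ` only `w τ`
        -- contributes, with `p τ * κ l`.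
        span : ∀ (p : Fin (suc n) → Carrier) top → e top ≡ τ →
          (∀ l → τ <ᶠ l → p τ * κ l ≈ p l) →
          (∀ l → l ≤ᶠ τ → (∃ λ i → e i ≡ l) ⊎ p l ≈ 0#) →
          lincomb p s ∈D Λ′
        span p top refl beyond below = p ∘ e ,
          ≈ᴹ-sym (≈ᴹ-trans (combination e (p ∘ e)) (lincomb-cong {p = coordinates e (p ∘ e)} {p} s coordinate′))
          where
          vanish : ∀ l i → p l ≈ 0# → l ≤ᶠ τ → (r : Position (e i) l) → p (e i) * coefficient r ≈ 0#
          vanish l i pl≈0 l≤τ (diagonal refl) = trans (*-congʳ pl≈0) (zeroˡ _)
          vanish l i pl≈0 l≤τ (tail _ τ<l)    = contradiction l≤τ (ℕₚ.<⇒≱ τ<l)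
          vanish l i pl≈0 l≤τ (off _ _)       = zeroʳ _

          from-below : ∀ l → l ≤ᶠ τ → (∃ λ i → e i ≡ l) ⊎ p l ≈ 0# → coordinates e (p ∘ e) l ≈ p l
          from-below l l≤τ (inj₁ (i , refl)) = coordinate (p ∘ e) i
          from-below l l≤τ (inj₂ pl≈0) =
            trans (Sᴰ.sum-zero _ (λ i → vanish l i pl≈0 l≤τ (position (e i) l))) (sym pl≈0)

          from-beyond : ∀ l → τ <ᶠ l → coordinates e (p ∘ e) l ≈ p l
          from-beyond l τ<l = trans
            (Sᴰ.sum-single _ top (λ i i≢top → trans (*-congˡ (coefficient-off
              (λ { refl → ℕₚ.<⇒≱ τ<l (e≤τ i) }) (i≢top ∘ e-injective ∘ proj₁) (position (e i) l))) (zeroʳ _)))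
            (trans (*-congˡ (coefficient-tail τ<l (position τ l))) (beyond l τ<l))

          coordinate′ : ∀ l → coordinates e (p ∘ e) l ≈ p l
          coordinate′ l = [ (λ τ<l → from-beyond l τ<l) , (λ l≤τ → from-below l l≤τ (below l l≤τ)) ]′
            (ℕₚ.<-≤-connex (toℕ τ) (toℕ l))

-- Coordinates of the axis of a rotation in 𝓑(Λ).

module Rotation {c ℓ v ℓv} {k : DyadicLocalField c ℓ} {D : QuaternionDivisionAlgebra k}
                {V : SkewHermitianSpace D v ℓv} {n} (Λ : DiagonalLattice V (suc n))
                (ρ : SimpleRotation V) (ρ∈𝓑 : ρ ∈𝓑 Λ) where

  open QuaternionDivisionAlgebra D hiding (zero) renaming (refl to ≈-refl; _+_ to infixl 6 _+ᴰ_)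
  open SkewHermitianSpace V
  open LatticeProperties V
  open DiagonalLattice Λ
  open _∈𝓑_ ρ∈𝓑
  open Algebra.Properties.Ring ring using (-0#≈0#)
  private
    module Σᴹ = Algebra.Properties.CommutativeMonoid.Sum +ᴹ-commutativeMonoid
    module Sᴹ = SumProperties +ᴹ-commutativeMonoid

  -- `λₗ` carries information only beyond `m`, so the second conditional masks its other values.
  axis : Fin (suc n) → Carrier
  axis l = (if does (l Finₚ.≟ m) then 1# - r else 0#) +ᴰ - (if does (m Finₚ.<? l) then λₗ l else 0#)

  axis-below : ∀ {l} → l <ᶠ m → axis l ≈ 0#
  axis-below {l} l<m = trans
    (reflexive (cong₂ (λ x y → (if x then 1# - r else 0#) +ᴰ - (if y then λₗ l else 0#))
      (dec-false (l Finₚ.≟ m) (Finₚ.<⇒≢ l<m)) (dec-false (m Finₚ.<? l) (ℕₚ.<⇒≯ l<m))))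
    (trans (+-identityˡ _) -0#≈0#)

  axis-above : ∀ {l} → m <ᶠ l → axis l ≈ - λₗ l
  axis-above {l} m<l = trans
    (reflexive (cong₂ (λ x y → (if x then 1# - r else 0#) +ᴰ - (if y then λₗ l else 0#))
      (dec-false (l Finₚ.≟ m) (Finₚ.<⇒≢ m<l ∘ ≡.sym)) (dec-true (m Finₚ.<? l) m<l)))
    (+-identityˡ _)

  private
    if-*ₗ : ∀ x q y → (if x then q *ₗ y else 0ᴹ) ≈ᴹ (if x then q else 0#) *ₗ y
    if-*ₗ true  q y = ≈ᴹ-refl
    if-*ₗ false q y = ≈ᴹ-sym (*ₗ-zeroˡ y)

  s≈axis : SimpleRotation.s ρ ≈ᴹ lincomb axis s
  s≈axis = ≈ᴹ-trans s-eq (≈ᴹ-trans (+ᴹ-cong first second) (lincomb-+ δ (λ l → - rest l) s))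
    where
    δ rest : Fin (suc n) → Carrier
    δ    l = if does (l Finₚ.≟ m) then 1# - r else 0#
    rest l = if does (m Finₚ.<? l) then λₗ l else 0#

    first : (1# - r) *ₗ s m ≈ᴹ lincomb δ s
    first = ≈ᴹ-sym (≈ᴹ-trans
      (Sᴹ.sum-single _ m (λ l l≢m → ≈ᴹ-trans
        (*ₗ-congʳ (reflexive (cong (λ x → if x then 1# - r else 0#) (dec-false (l Finₚ.≟ m) l≢m)))) (*ₗ-zeroˡ (s l))))
      (*ₗ-congʳ (reflexive (cong (λ x → if x then 1# - r else 0#) (dec-true (m Finₚ.≟ m) refl)))))

    second : -ᴹ s₀ ≈ᴹ lincomb (λ l → - rest l) s
    second = begin
      -ᴹ s₀                                ≈⟨ -ᴹ‿cong (Σᴹ.sum-cong-≋ {y = λ l → rest l *ₗ s l} (λ l → if-*ₗ (does (m Finₚ.<? l)) (λₗ l) (s l))) ⟩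
      -ᴹ lincomb rest s                    ≈⟨ -ᴹ‿cong (*ₗ-identityˡ _) ⟨
      -ᴹ (1# *ₗ lincomb rest s)            ≈⟨ -ᴹ-*ₗ 1# _ ⟩
      (- 1#) *ₗ lincomb rest s             ≈⟨ *ₗ-lincomb (- 1#) rest s ⟩
      lincomb (λ l → - 1# * rest l) s      ≈⟨ lincomb-cong s (λ l → -1*x≈-x (rest l)) ⟩
      lincomb (λ l → - rest l) s           ∎
      where
      open Relation.Binary.Reasoning.Setoid ≈ᴹ-setoid
      open Algebra.Properties.Ring ring using (-1*x≈-x)

-- The refined lattice attached to a rotation in 𝓑(Λ).

open import Data.Nat.Base using (_+_; _≤_)

theorem2 : ∀ {c ℓ v ℓv} (k : DyadicLocalField c ℓ) (D : QuaternionDivisionAlgebra k)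
    (V : SkewHermitianSpace D v ℓv) (n : ℕ) (Λ : DiagonalLattice V (suc n)) →
    let open QuaternionDivisionAlgebra D using (ν)
        open QuaternionDivisionAlgebra D using (N)
        open QuaternionDivisionAlgebra D using (4#)
        open QuaternionDivisionAlgebra D using (∣_∣≤∣_∣)
        open QuaternionDivisionAlgebra D using (_∈_k*²)
        open DiagonalLattice using (a)
    in
    Ascending Λ →
    ν 4# <⁺ μ Λ →
    (∀ (i : Fin n) → N (a Λ (suc i)) ∈ N (a Λ zero) k*²) →
    (ρ : SimpleRotation V) (ρ∈𝓑 : ρ ∈𝓑 Λ) →
    let open _∈𝓑_ ρ∈𝓑 using (m)
        open _∈𝓑_ ρ∈𝓑 using (λₗ)
    in
    (t : ℕ) → 1 ≤ t →
    (m+t : Fin (suc n)) → toℕ m+t ≡ toℕ m + t →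
    (∀ (l : Fin (suc n)) → m+t <ᶠ l → ∣ λₗ l ∣≤∣ λₗ m+t ∣) →
    ∃ λ (Λ′ : DiagonalLattice V (suc t)) →
      Λ′ ⊆ Λ
      × ρ ∈𝓤⁺ Λ′
      × (Ascending Λ′ × μ Λ ≤⁺ μ Λ′)
      × (∀ (i : Fin (suc t)) → N (a Λ′ i) ∈ N (a Λ zero) k*²)
theorem2 k D V n Λ ascending ν4<μ squares ρ ρ∈𝓑 t 1≤t m+t m+t-eq dominant =
  Λ′ , Λ′⊆Λ ,
  𝓤⁺-restrict Λ′ Λ ρ Λ′⊆Λ DΛ′⊆DΛ saturated s∈DΛ′ ρ∈𝓤⁺ ,
  (ascending′ , ⊓∞-foldr-glb _ differences) ,
  squares′
  where
  module k = DyadicLocalField k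
  module kₚ = FieldProperties k
  open QuaternionDivisionAlgebra D hiding (zero) renaming (refl to ≈-refl; _+_ to infixl 6 _+ᴰ_)
  open QuaternionProperties D
  open SkewHermitianSpace V using (≈ᴹ-trans)
  open LatticeProperties V
  open DiagonalLattice Λ
  open _∈𝓑_ ρ∈𝓑 using (m; λₗ; ρ∈𝓤⁺)
  open Rotation Λ ρ ρ∈𝓑
  open Algebra.Properties.Ring ring using (-‿distribˡ-*)

  -- A value strictly below another is finite, so the assumption on `μ Λ` already gives this.
  4≉0 : 4# ≉ 0#
  4≉0 = ν-≉0 (proj₂ (finite ν4<μ))

  gap-suc : ∀ i → ν (a (inject₁ i)) +∞ ν 4# <⁺ ν (a (suc i))
  gap-suc i = subst (λ u → u +∞ ν 4# <⁺ ν (a (suc i))) (≡.sym ν≡)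
    (<-∞⇒+∞< _ (subst (λ u → ν 4# <⁺ ν (a (suc i)) -∞ u) ν≡
      (<-≤∞-trans ν4<μ (⊓∞-foldr-≤ _ i))))
    where
    ν≡ = proj₂ (ν-finite (a≉0 (inject₁ i)))

  -- Monotonicity leads from `j` to the index just before `l`; the strict gap comes from the last
  -- step.
  gap : ∀ {j l} → j <ᶠ l → ν (a j) +∞ ν 4# <⁺ ν (a l)
  gap {j} {suc l} (ℕ.s≤s j≤l) = ≤-<∞-trans
    (+∞-mono-≤ (ascending⇒monotone (ν ∘ a) ascending j (inject₁ l)
      (subst (toℕ j ℕ.≤_) (≡.sym (Finₚ.toℕ-inject₁ l)) j≤l)) ≤∞-refl)
    (gap-suc l)

  -- Since t ≥ 1, the axis coordinate at `m+t` is a -λ and not 1 - r.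
  m<m+t : m <ᶠ m+t
  m<m+t = subst (toℕ m ℕ.<_) (≡.sym m+t-eq) (ℕₚ.m<m+n (toℕ m) 1≤t)

  quotient : ∀ l → ∃ λ κ → 𝓞 κ × (m+t <ᶠ l → λₗ m+t * κ ≈ λₗ l)
  quotient l with m+t Finₚ.<? l
  -- A default value: `M` reads κ only beyond `m+t`.
  ... | no  m+t≮l = 0# , 𝓞-0 , λ m+t<l → contradiction m+t<l m+t≮l
  ... | yes m+t<l = from-divide (divide (λₗ m+t) (λₗ l) (dominant l m+t<l))
    where
    from-divide : (∃ λ κ → 𝓞 κ × λₗ m+t * κ ≈ λₗ l) → ∃ λ κ → 𝓞 κ × (m+t <ᶠ l → λₗ m+t * κ ≈ λₗ l)
    from-divide (κ , κ∈𝓞 , e) = κ , κ∈𝓞 , λ _ → e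

  open Refinement Λ m+t (proj₁ ∘ quotient) (λ l → proj₁ (proj₂ (quotient l)))

  m+i<1+n : ∀ (i : Fin (suc t)) → toℕ m + toℕ i ℕ.< suc n
  m+i<1+n i = ℕₚ.≤-<-trans (ℕₚ.+-monoʳ-≤ (toℕ m) (Finₚ.toℕ≤pred[n] i))
    (subst (ℕ._< suc n) m+t-eq (Finₚ.toℕ<n m+t))

  e : Fin (suc t) → Fin (suc n)
  e i = fromℕ< (m+i<1+n i)

  toℕ-e : ∀ i → toℕ (e i) ≡ toℕ m + toℕ i
  toℕ-e i = Finₚ.toℕ-fromℕ< (m+i<1+n i)

  e-injective : ∀ {i j} → e i ≡ e j → i ≡ j
  e-injective {i} {j} ei≡ej = Finₚ.toℕ-injective (ℕₚ.+-cancelˡ-≡ (toℕ m) _ _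
    (≡.trans (≡.sym (toℕ-e i)) (≡.trans (cong toℕ ei≡ej) (toℕ-e j))))

  e≤m+t : ∀ i → e i ≤ᶠ m+t
  e≤m+t i = subst₂ ℕ._≤_ (≡.sym (toℕ-e i)) (≡.sym m+t-eq) (ℕₚ.+-monoʳ-≤ (toℕ m) (Finₚ.toℕ≤pred[n] i))

  open Sublattice gap 4≉0 e e-injective e≤m+t

  e-top : e (fromℕ t) ≡ m+t
  e-top = Finₚ.toℕ-injective (≡.trans (toℕ-e (fromℕ t))
    (≡.trans (cong (λ u → toℕ m + u) (Finₚ.toℕ-fromℕ t)) (≡.sym m+t-eq)))

  below : ∀ l → l ≤ᶠ m+t → (∃ λ i → e i ≡ l) ⊎ axis l ≈ 0#
  below l l≤m+t = [ (λ l<m → inj₂ (axis-below l<m)) , (λ m≤l → inj₁ (index m≤l)) ]′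
    (ℕₚ.<-≤-connex (toℕ l) (toℕ m))
    where
    index : m ≤ᶠ l → ∃ λ i → e i ≡ l
    index m≤l = fromℕ< l-m<1+t , Finₚ.toℕ-injective (≡.trans (toℕ-e (fromℕ< l-m<1+t))
      (≡.trans (cong (λ u → toℕ m + u) (Finₚ.toℕ-fromℕ< l-m<1+t)) (ℕₚ.m+[n∸m]≡n m≤l)))
      where
      l-m<1+t : toℕ l ℕ.∸ toℕ m ℕ.< suc t
      l-m<1+t = ℕ.s≤s (ℕₚ.m≤n+o⇒m∸n≤o (toℕ l) (toℕ m) (subst (toℕ l ℕ.≤_) m+t-eq l≤m+t))

  -- Both axis coordinates carry a minus sign, so the quotients of the λ are also those of the axis.
  beyond : ∀ l → m+t <ᶠ l → axis m+t * proj₁ (quotient l) ≈ axis l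
  beyond l m+t<l = trans (*-congʳ (axis-above m<m+t)) (trans (sym (-‿distribˡ-* _ _))
    (trans (-‿cong (proj₂ (proj₂ (quotient l)) m+t<l)) (sym (axis-above (ℕₚ.<-trans m<m+t m+t<l)))))

  s∈DΛ′ : SimpleRotation.s ρ ∈D Λ′
  s∈DΛ′ = respects (span axis (fromℕ t) e-top beyond below)
    where
    respects : SkewHermitianSpace.lincomb V axis s ∈D Λ′ → SimpleRotation.s ρ ∈D Λ′
    respects (q , s≈) = q , ≈ᴹ-trans s≈axis s≈

  e-consecutive : ∀ (i : Fin t) → ∃ λ j → inject₁ j ≡ e (inject₁ i) × suc j ≡ e (suc i)
  e-consecutive i = consecutive _ _ (≡.trans (toℕ-e (suc i)) (≡.trans (ℕₚ.+-suc (toℕ m) (toℕ i))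
    (cong suc (≡.sym (≡.trans (toℕ-e (inject₁ i)) (cong (λ u → toℕ m + u) (Finₚ.toℕ-inject₁ i)))))))

  -- `e` is a shift by `m` and ν(b j) = ν(a j), so relations between adjacent values pass from Λ to
  -- Λ′.
  transfer : ∀ (P : ℤ∞ → ℤ∞ → Set) → (∀ j → P (ν (a (inject₁ j))) (ν (a (suc j)))) →
    ∀ i → P (ν (b (e (inject₁ i)))) (ν (b (e (suc i))))
  transfer P Pa i = subst₂ P
    (≡.trans (cong (ν ∘ a) (proj₁ (proj₂ (e-consecutive i)))) (≡.sym (ν-b gap 4≉0 _)))
    (≡.trans (cong (ν ∘ a) (proj₂ (proj₂ (e-consecutive i)))) (≡.sym (ν-b gap 4≉0 _)))
    (Pa (proj₁ (e-consecutive i)))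

  ascending′ : Ascending Λ′
  ascending′ = transfer _≤⁺_ ascending

  differences : ∀ i → μ Λ ≤⁺ ν (b (e (suc i))) -∞ ν (b (e (inject₁ i)))
  differences = transfer (λ x y → μ Λ ≤⁺ y -∞ x) (⊓∞-foldr-≤ _)

  squares-all : ∀ j → N (a j) ∈ N (a zero) k*²
  squares-all zero    = k.1# , kₚ.1≉0 , k.sym (k.trans (k.*-congˡ (k.*-identityˡ _)) (k.*-identityʳ _))
  squares-all (suc i) = squares i

  squares′ : ∀ i → N (b (e i)) ∈ N (a zero) k*²
  squares′ i = k*²-trans (from-N-b (N-b gap 4≉0 (e i))) (squares-all (e i))
    where
    from-N-b : (∃ λ z → k.ν z ≡ [ 0ℤ ] × N (b (e i)) k.≈ N (a (e i)) k.* (z k.* z)) → N (b (e i)) ∈ N (a (e i)) k*²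
    from-N-b (z , νz≡0 , eq) = z , kₚ.≉0 νz≡0 , eq
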